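{- For $n\in\mathbb{N}$ let $H_n:=\{(x,y)\in\mathbb{R}_{\ge0}^2: xy\ge n\}$. There is an algorithm that, with input $n\in\mathbb{N}$ and a vertex $\mathbf p=(\mathbf p_x,\mathbf p_y)$ of $\mathrm{conv}(H_n\cap\mathbb{Z}^2)$, finds the next vertex $\mathbf p'=(\mathbf p'_x,\mathbf p'_y)$ using at most $O(\log n)$ arithmetic operations. Here "next" means that \[ \mathbf p'_x=\min\{x>\mathbf p_x : (x,y)\in \mathrm{vert}(\mathrm{conv}(H_n\cap\mathbb{Z}^2)) \text{ for some } y\}. \]
   Context: Complexity is measured in the arithmetic (RAM) model: comparisons, additions, subtractions, multiplications, integer divisions $\lfloor b/a\rfloor$ and integer square roots $\lfloor\sqrt a\rfloor$ each cost $O(1)$. $\mathrm{conv}$ denotes convex hull and $\mathrm{vert}$ the set of vertices. -}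

module Defs where

open import Data.Nat as ℕ using (ℕ; zero; suc)
open import Data.Integer as ℤ using (ℤ; +_; -[1+_])
import Data.Integer.DivMod as ℤD
open import Data.Rational as ℚ using (ℚ)
open import Data.Bool using (Bool; true; false; if_then_else_)
open import Data.List using (List; []; _∷_; lookup; length)
open import Data.List.Relation.Unary.All using (All)
open import Data.Maybe using (Maybe; just; nothing)
open import Data.Product using (_×_; _,_; proj₁; proj₂; ∃)
open import Relation.Binary.PropositionalEquality using (_≡_)
open import Relation.Nullary using (¬_)
open import Relation.Nullary.Decidable using (⌊_⌋)

InH : ℕ → ℤ × ℤ → Set
InH n (x , y) = (+ 0 ℤ.≤ x) × (+ 0 ℤ.≤ y) × (+ n ℤ.≤ x ℤ.* y)

Pt : Set
Pt = ℚ × ℚ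

embed : ℤ × ℤ → Pt
embed (x , y) = (x ℚ./ 1 , y ℚ./ 1)

weightSum : List (ℚ × (ℤ × ℤ)) → ℚ
weightSum [] = ℚ.0ℚ
weightSum ((w , _) ∷ l) = w ℚ.+ weightSum l

combX : List (ℚ × (ℤ × ℤ)) → ℚ
combX [] = ℚ.0ℚ
combX ((w , (x , _)) ∷ l) = w ℚ.* (x ℚ./ 1) ℚ.+ combX l

combY : List (ℚ × (ℤ × ℤ)) → ℚ
combY [] = ℚ.0ℚ
combY ((w , (_ , y)) ∷ l) = w ℚ.* (y ℚ./ 1) ℚ.+ combY l

InConv : ℕ → Pt → Set
InConv n q = ∃ λ (l : List (ℚ × (ℤ × ℤ))) →
    All (λ wp → (ℚ.0ℚ ℚ.≤ proj₁ wp) × InH n (proj₂ wp)) l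
  × weightSum l ≡ ℚ.1ℚ
  × combX l ≡ proj₁ q
  × combY l ≡ proj₂ q

IsVertex : ℕ → ℤ × ℤ → Set
IsVertex n p =
    InConv n (embed p)
  × (∀ (a b : Pt) (t : ℚ) → InConv n a → InConv n b →
       ℚ.0ℚ ℚ.< t → t ℚ.< ℚ.1ℚ →
       proj₁ (embed p) ≡ t ℚ.* proj₁ a ℚ.+ (ℚ.1ℚ ℚ.- t) ℚ.* proj₁ b →
       proj₂ (embed p) ≡ t ℚ.* proj₂ a ℚ.+ (ℚ.1ℚ ℚ.- t) ℚ.* proj₂ b →
       a ≡ b)

IsNextVertex : ℕ → ℤ × ℤ → ℤ × ℤ → Set
IsNextVertex n p p' =
    IsVertex n p'
  × (proj₁ p ℤ.< proj₁ p')
  × (∀ q → IsVertex n q → proj₁ p ℤ.< proj₁ q → proj₁ p' ℤ.≤ proj₁ q)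

-- Arithmetic RAM model (unit cost per executed instruction).

-- ⌊b / a⌋ (floor division); division by 0 is defined to give 0.
floorDiv : ℤ → ℤ → ℤ
floorDiv b (+ zero)    = + 0
floorDiv b (+ suc k)   = b ℤD./ (+ suc k)
floorDiv b (-[1+ k ])  = (ℤ.- b) ℤD./ (+ suc k)

isqrtℕ : ℕ → ℕ
isqrtℕ zero = zero
isqrtℕ (suc m) =
  let r = isqrtℕ m in
  if ⌊ suc r ℕ.* suc r ℕ.≤? suc m ⌋ then suc r else r

-- ⌊√a⌋ on ℤ; negative arguments give 0.
isqrtℤ : ℤ → ℤ
isqrtℤ (+ m) = + isqrtℕ m
isqrtℤ -[1+ _ ] = + 0

data Op : Set where
  add sub mul div : Op

applyOp : Op → ℤ → ℤ → ℤ
applyOp add a b = a ℤ.+ b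
applyOp sub a b = a ℤ.- b
applyOp mul a b = a ℤ.* b
applyOp div a b = floorDiv a b

data Instr : Set where
  const : (r : ℕ) → ℤ → Instr
  arith : Op → (r a b : ℕ) → Instr
  sqrt  : (r a : ℕ) → Instr
  jle   : (a b : ℕ) → (lbl : ℕ) → Instr
  jmp   : (lbl : ℕ) → Instr
  halt  : Instr

Program : Set
Program = List Instr

Regs : Set
Regs = ℕ → ℤ

update : Regs → ℕ → ℤ → Regs
update R r v i = if ⌊ i ℕ.≟ r ⌋ then v else R i

fetch : Program → ℕ → Instr
fetch [] _ = halt                     -- falling off the program halts
fetch (i ∷ _) zero = i
fetch (_ ∷ P) (suc k) = fetch P k

-- run P t pc R : result registers if the machine halts within t executed
-- instructions (each instruction, including the final halt, costs 1).
run : Program → ℕ → ℕ → Regs → Maybe Regs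
run P zero pc R = nothing
run P (suc t) pc R with fetch P pc
... | const r c     = run P t (suc pc) (update R r c)
... | arith o r a b = run P t (suc pc) (update R r (applyOp o (R a) (R b)))
... | sqrt r a      = run P t (suc pc) (update R r (isqrtℤ (R a)))
... | jle a b l     = if ⌊ R a ℤ.≤? R b ⌋ then run P t l R else run P t (suc pc) R
... | jmp l         = run P t l R
... | halt          = just R

initRegs : ℕ → ℤ × ℤ → Regs
initRegs n (px , py) zero = + n
initRegs n (px , py) (suc zero) = px
initRegs n (px , py) (suc (suc zero)) = py
initRegs n (px , py) (suc (suc (suc _))) = + 0

{-# OPTIONS --safe #-}

-- Write (x , y) for the displacement (x , −y) from the vertex p, and call it feasible
-- if it leads into H_n. The next vertex is p + m u, where u is the steepest feasible
-- primitive displacement and m is the largest feasible multiple. The search keeps a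
-- lattice basis u, v with u feasible and v steeper than every feasible displacement.
-- First u is replaced by u + j v with j maximal; then the least k is computed for which
-- k u + v is feasible. By convexity of the hyperbola, if there is no such k then nothing
-- feasible is steeper than u; otherwise (k u + v , (k − 1) u + v) is the next basis.
-- Both j and k come from the quadratic formula with an integer square root.
-- Maximality of j forces k ≥ 2, so the vertical component of u doubles in each round,
-- and it is bounded by p_y ≤ n.

module Submission where

open import Defs
open import Data.Nat as ℕ using (ℕ; zero; suc; _^_)
import Data.Nat.Properties as ℕₚ
open import Data.Nat.Logarithm using (⌊log₂_⌋; ⌊log₂⌋-mono-≤; ⌊log₂[2^n]⌋≡n)
open import Data.Fin using (Fin; zero; suc; toℕ; #_)
import Data.Fin.Properties as Finₚ
open import Data.Integer as ℤ using (ℤ; +_; -[1+_]; _+_; _*_; _-_; -_; _≤_; _<_; +≤+; _≤?_)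
import Data.Integer.DivMod as ℤD
open import Data.Integer.Properties as ℤₚ using (≤-trans; ≤-refl; ≰⇒>)
open import Data.Integer.Tactic.RingSolver using (solve-∀)
open import Data.Rational as ℚ using (ℚ; 0ℚ; 1ℚ; 1/_)
open import Data.Rational.Unnormalised as ℚᵘ using (mkℚᵘ; *≡*; *≤*)
import Data.Rational.Unnormalised.Properties as ℚᵘₚ
import Data.Rational.Properties as ℚₚ
import Tactic.RingSolver as RS
import Tactic.RingSolver.Core.AlmostCommutativeRing as ACR
open import Data.List using (List; []; _∷_; _++_; map; length)
import Data.List.Properties as Listₚ
open import Data.List.Relation.Unary.All using (All; []; _∷_)
open import Data.Vec using (Vec; []; _∷_; lookup; _[_]≔_)
import Data.Vec.Properties as Vecₚ
open import Data.Maybe using (Maybe; just; nothing)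
open import Data.Product using (_×_; _,_; ∃; Σ; proj₁; proj₂)
open import Data.Sum using (_⊎_; inj₁; inj₂)
open import Data.Empty using (⊥; ⊥-elim)
open import Level using (0ℓ)
open import Relation.Binary.PropositionalEquality using (_≡_; refl; sym; trans; cong; cong₂; subst; subst₂; module ≡-Reasoning)
open import Relation.Nullary using (¬_; yes; no)

-- Integer inequalities

-- Hull membership is taken apart only through linear functionals with integer coefficients, and
-- extremality is applied only to integer combinations of three points; the rest is integer
-- arithmetic. Three obstacles shape the search. The quadratic formula divides by twice the product
-- of the coordinates of the direction, so the axes cannot serve as the first basis; two starting
-- bases with positive coordinates replace them. A line may miss H_n or meet it between lattice
-- points, and then the computed k is meaningless, so its sign and its feasibility are tested.
-- Finally, the last edge may carry several lattice points, so its supporting line does not single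
-- out a vertex; a slightly tilted functional does.

NN : ℤ → Set
NN e = + 0 ≤ e

infixl 6 _⊕_
infixl 7 _⊗_

_⊕_ : ∀ {a b} → NN a → NN b → NN (a + b)
_⊕_ = ℤₚ.+-mono-≤

_⊗_ : ∀ {a b} → NN a → NN b → NN (a * b)
_⊗_ {+ m} {+ n} _ _ = subst NN (ℤₚ.pos-* m n) (+≤+ ℕ.z≤n)

gap : ∀ {a b} → a ≤ b → NN (b - a)
gap = ℤₚ.i≤j⇒0≤j-i

ungap : ∀ {a b} → NN (b - a) → a ≤ b
ungap = ℤₚ.0≤i-j⇒j≤i

-- Inequalities are proved by certificates: a combination of known nonnegative terms is shown by the
-- ring solver to equal b - a. In `absurd` the combination equals -1, which refutes the assumptions.
by : ∀ {e a b} → NN e → e ≡ b - a → a ≤ b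
by h eq = ungap (subst NN eq h)

absurd : ∀ {e} → NN e → e ≡ -[1+ 0 ] → ⊥
absurd h refl with h
... | ()

≰⇒1+≤ : ∀ {a b} → ¬ (a ≤ b) → b + + 1 ≤ a
≰⇒1+≤ {a} {b} h = subst (_≤ a) (ℤₚ.+-comm (+ 1) b) (ℤₚ.i<j⇒suc[i]≤j (≰⇒> h))

1+≤⇒≰ : ∀ {a b} → b + + 1 ≤ a → ¬ (a ≤ b)
1+≤⇒≰ {a} {b} h k = absurd (gap h ⊕ gap k) (eq a b)
  where
  eq : ∀ a b → a - (b + + 1) + (b - a) ≡ - (+ 1)
  eq = solve-∀

≤-or-> : ∀ a b → a ≤ b ⊎ b + + 1 ≤ a
≤-or-> a b with a ≤? b
... | yes h = inj₁ h
... | no h  = inj₂ (≰⇒1+≤ h)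

≤⇒≡⊎1+≤ : ∀ {a b} → a ≤ b → a ≡ b ⊎ a + + 1 ≤ b
≤⇒≡⊎1+≤ {a} {b} h with ≤-or-> b a
... | inj₁ k = inj₁ (ℤₚ.≤-antisym h k)
... | inj₂ k = inj₂ k

NN-sq : ∀ a → NN (a * a)
NN-sq (+ m)    = _⊗_ {+ m} {+ m} (+≤+ ℕ.z≤n) (+≤+ ℕ.z≤n)
NN-sq -[1+ m ] = +≤+ ℕ.z≤n

NN-cancel : ∀ {k a} → + 1 ≤ k → NN (k * a) → NN a
NN-cancel {k} {a} k≥1 h with ≤-or-> (+ 0) a
... | inj₁ p = p
... | inj₂ p = ⊥-elim (absurd (h ⊕ gap k≥1 ⊗ gap p ⊕ gap k≥1 ⊕ gap p) (eq k a))
  where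
  eq : ∀ k a → k * a + (k - + 1) * (+ 0 - (a + + 1)) + (k - + 1) + (+ 0 - (a + + 1)) ≡ - (+ 1)
  eq = solve-∀

pos-left : ∀ {x y N} → + 1 ≤ N → NN y → N ≤ x * y → + 1 ≤ x
pos-left {x} {y} {N} N≥1 y≥0 h with ≤-or-> (+ 1) x
... | inj₁ p = p
... | inj₂ p = ⊥-elim (absurd (gap h ⊕ gap p ⊗ y≥0 ⊕ gap N≥1) (eq x y N))
  where
  eq : ∀ x y N → x * y - N + (+ 1 - (x + + 1)) * y + (N - + 1) ≡ - (+ 1)
  eq = solve-∀

pos-right : ∀ {x y N} → + 1 ≤ N → NN x → N ≤ x * y → + 1 ≤ y
pos-right {x} {y} N≥1 x≥0 h = pos-left N≥1 x≥0 (subst (_ ≤_) (ℤₚ.*-comm x y) h)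

-- Floor and ceiling quotients, integer square roots, quadratic inequalities

floor-≤ : ∀ {t b d} → + 1 ≤ d → t ≤ floorDiv b d → t * d ≤ b
floor-≤ {t} {b} {+ suc k} _ h =
  by (gap h ⊗ (+≤+ ℕ.z≤n) ⊕ gap (ℤD.[n/d]*d≤n b (+ suc k))) (eq t b (b ℤD./ + suc k) (+ suc k))
  where
  eq : ∀ t b f d → (f - t) * d + (b - f * d) ≡ b - t * d
  eq = solve-∀
floor-≤ {d = + zero} (+≤+ ()) _

≤-floor : ∀ {t b d} → + 1 ≤ d → t * d ≤ b → t ≤ floorDiv b d
≤-floor {t} {b} {+ suc k} _ h with ≤-or-> t (b ℤD./ + suc k)
... | inj₁ p = p
... | inj₂ p = ⊥-elim (absurd (gap h ⊕ gap p ⊗ (+≤+ ℕ.z≤n) ⊕ gap lt) (eq t b (b ℤD./ + suc k) (+ suc k)))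
  where
  open ℤD
  lt : b + + 1 ≤ (+ 1 + b / + suc k) * + suc k
  lt = subst₂ _≤_ (ℤₚ.+-comm (+ 1) b) (cong (λ z → (+ 1 + z) * + suc k) (sym (div-pos-is-/ℕ b (suc k))))
         (ℤₚ.i<j⇒suc[i]≤j (n<s[n/ℕd]*d b (suc k)))
  eq : ∀ t b f d → b - t * d + (t - (f + + 1)) * d + ((+ 1 + f) * d - (b + + 1)) ≡ - (+ 1)
  eq = solve-∀
≤-floor {d = + zero} (+≤+ ()) _

ceilDiv : ℤ → ℤ → ℤ
ceilDiv b d = + 0 - floorDiv (+ 0 - b) d

≤-ceil* : ∀ {b d} → + 1 ≤ d → b ≤ ceilDiv b d * d
≤-ceil* {b} {d} d≥1 = by (gap (floor-≤ {floorDiv (+ 0 - b) d} d≥1 ≤-refl)) (eq b d (floorDiv (+ 0 - b) d))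
  where
  eq : ∀ b d f → + 0 - b - f * d ≡ (+ 0 - f) * d - b
  eq = solve-∀

ceil-≤ : ∀ {t b d} → + 1 ≤ d → b ≤ t * d → ceilDiv b d ≤ t
ceil-≤ {t} {b} {d} d≥1 h =
  by (gap (≤-floor {+ 0 - t} d≥1 (by (gap h) (eq₁ t b d)))) (eq₂ t (floorDiv (+ 0 - b) d))
  where
  eq₁ : ∀ t b d → t * d - b ≡ + 0 - b - (+ 0 - t) * d
  eq₁ = solve-∀
  eq₂ : ∀ t f → f - (+ 0 - t) ≡ t - (+ 0 - f)
  eq₂ = solve-∀

isqrtℕ-spec : ∀ m → isqrtℕ m ℕ.* isqrtℕ m ℕ.≤ m × m ℕ.< suc (isqrtℕ m) ℕ.* suc (isqrtℕ m)
isqrtℕ-spec zero = ℕ.z≤n , ℕ.s≤s ℕ.z≤n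
isqrtℕ-spec (suc m) with suc (isqrtℕ m) ℕ.* suc (isqrtℕ m) ℕ.≤? suc m
... | yes h = h , ℕₚ.≤-<-trans (proj₂ (isqrtℕ-spec m)) (ℕₚ.*-mono-< (ℕₚ.n<1+n (suc (isqrtℕ m))) (ℕₚ.n<1+n (suc (isqrtℕ m))))
... | no  h = ℕₚ.m≤n⇒m≤1+n (proj₁ (isqrtℕ-spec m)) , ℕₚ.≰⇒> h

isqrtℤ-lower : ∀ {D} → NN D → isqrtℤ D * isqrtℤ D ≤ D
isqrtℤ-lower {+ m} _ = subst (_≤ + m) (ℤₚ.pos-* (isqrtℕ m) (isqrtℕ m)) (+≤+ (proj₁ (isqrtℕ-spec m)))

isqrtℤ-upper : ∀ {D} → NN D → D + + 1 ≤ (isqrtℤ D + + 1) * (isqrtℤ D + + 1)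
isqrtℤ-upper {+ m} _ =
  subst₂ _≤_ (cong +_ (ℕₚ.+-comm 1 m))
    (trans (ℤₚ.pos-* (suc r) (suc r)) (cong (λ z → + z * + z) (ℕₚ.+-comm 1 r)))
    (+≤+ (proj₂ (isqrtℕ-spec m)))
  where
  r = isqrtℕ m

isqrtℤ-NN : ∀ D → NN (isqrtℤ D)
isqrtℤ-NN (+ m)    = +≤+ ℕ.z≤n
isqrtℤ-NN -[1+ m ] = +≤+ ℕ.z≤n

sq≤⇒≤isqrt : ∀ {z D} → z * z ≤ D → z ≤ isqrtℤ D
sq≤⇒≤isqrt {z} {D} h with ≤-or-> z (isqrtℤ D)
... | inj₁ p = p
... | inj₂ p = ⊥-elim (absurd
      (gap h ⊕ gap (isqrtℤ-upper (≤-trans (NN-sq z) h))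
        ⊕ gap p ⊗ (gap p ⊕ isqrtℤ-NN D ⊕ isqrtℤ-NN D ⊕ +≤+ (ℕ.z≤n {2}))) (eq z D (isqrtℤ D)))
  where
  eq : ∀ z D s → D - z * z + ((s + + 1) * (s + + 1) - (D + + 1))
                 + (z - (s + + 1)) * (z - (s + + 1) + s + s + + 2) ≡ - (+ 1)
  eq = solve-∀

≤isqrt⇒sq≤ : ∀ {z D} → NN D → z ≤ isqrtℤ D → - z ≤ isqrtℤ D → z * z ≤ D
≤isqrt⇒sq≤ {z} {D} D≥0 h k = by (gap h ⊗ gap k ⊕ gap (isqrtℤ-lower D≥0)) (eq z D (isqrtℤ D))
  where
  eq : ∀ z D s → (s - z) * (s - - z) + (D - s * s) ≡ D - z * z
  eq = solve-∀

-- If the product of the coordinates is at least N somewhere on the line (X + t dx , Y − t dy),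
-- then the integers t for which it is are those with quadLo ≤ t ≤ quadHi.
quad2A : (dx dy : ℤ) → ℤ
quad2A dx dy = dx * dy + dx * dy

quadB : (X Y dx dy : ℤ) → ℤ
quadB X Y dx dy = dx * Y - dy * X

quadD : (N X Y dx dy : ℤ) → ℤ
quadD N X Y dx dy =
  quad2A dx dy * (X * Y - N) + quad2A dx dy * (X * Y - N) + quadB X Y dx dy * quadB X Y dx dy

opaque
  quadLo quadHi : (N X Y dx dy : ℤ) → ℤ
  -- A negated floor is a ceiling: this is the quotient (B - s) / 2A rounded up, where s is the
  -- integer root of D.
  quadLo N X Y dx dy = + 0 - floorDiv (isqrtℤ (quadD N X Y dx dy) - quadB X Y dx dy) (quad2A dx dy)
  quadHi N X Y dx dy = floorDiv (quadB X Y dx dy + isqrtℤ (quadD N X Y dx dy)) (quad2A dx dy)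

module Quad (N X Y dx dy : ℤ) (dx≥1 : + 1 ≤ dx) (dy≥1 : + 1 ≤ dy) where

  private
    A2 B D s : ℤ
    A2 = quad2A dx dy
    B  = quadB X Y dx dy
    D  = quadD N X Y dx dy
    s  = isqrtℤ D

    z : ℤ → ℤ
    z t = t * A2 - B

    A2≥1 : + 1 ≤ A2
    A2≥1 = by (gap dx≥1 ⊗ gap dy≥1 ⊕ gap dx≥1 ⊗ gap dy≥1 ⊕ gap dx≥1 ⊕ gap dx≥1 ⊕ gap dy≥1 ⊕ gap dy≥1 ⊕ +≤+ (ℕ.z≤n {1})) (eq dx dy)
      where
      eq : ∀ x y → (x - + 1) * (y - + 1) + (x - + 1) * (y - + 1) + (x - + 1) + (x - + 1) + (y - + 1) + (y - + 1) + + 1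
                     ≡ x * y + x * y - + 1
      eq = solve-∀

    4A≥1 : + 1 ≤ A2 + A2
    4A≥1 = by (gap A2≥1 ⊕ gap A2≥1 ⊕ +≤+ (ℕ.z≤n {1})) (eq A2)
      where
      eq : ∀ a → a - + 1 + (a - + 1) + + 1 ≡ a + a - + 1
      eq = solve-∀

    -- Completing the square. An integer z satisfies z² ≤ D exactly when |z| ≤ ⌊√D⌋ (for D ≥ 0), so
    -- the integer root loses nothing.
    discriminant : ∀ t → D - z t * z t ≡ (A2 + A2) * ((X + t * dx) * (Y - t * dy) - N)
    discriminant t = eq N X Y dx dy t
      where
      eq : ∀ N X Y dx dy t →
           (dx * dy + dx * dy) * (X * Y - N) + (dx * dy + dx * dy) * (X * Y - N)
             + (dx * Y - dy * X) * (dx * Y - dy * X)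
             - (t * (dx * dy + dx * dy) - (dx * Y - dy * X)) * (t * (dx * dy + dx * dy) - (dx * Y - dy * X))
           ≡ (dx * dy + dx * dy + (dx * dy + dx * dy)) * ((X + t * dx) * (Y - t * dy) - N)
      eq = solve-∀

    sq≤D : ∀ t → N ≤ (X + t * dx) * (Y - t * dy) → z t * z t ≤ D
    sq≤D t h = ungap (subst NN (sym (discriminant t)) (≤-trans (+≤+ ℕ.z≤n) 4A≥1 ⊗ gap h))

  opaque
    unfolding quadLo quadHi

    lo≤ : ∀ {t} → N ≤ (X + t * dx) * (Y - t * dy) → quadLo N X Y dx dy ≤ t
    lo≤ {t} h = by (gap (≤-floor {+ 0 - t} A2≥1 (by (gap (sq≤⇒≤isqrt (subst (_≤ D) (eq₀ (z t)) (sq≤D t h)))) (eq₁ t A2 B s))))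
                   (eq₂ t (floorDiv (s - B) A2))
      where
      eq₀ : ∀ z → z * z ≡ - z * - z
      eq₀ = solve-∀
      eq₁ : ∀ t A B s → s - - (t * A - B) ≡ s - B - (+ 0 - t) * A
      eq₁ = solve-∀
      eq₂ : ∀ t f → f - (+ 0 - t) ≡ t - (+ 0 - f)
      eq₂ = solve-∀

    ≤hi : ∀ {t} → N ≤ (X + t * dx) * (Y - t * dy) → t ≤ quadHi N X Y dx dy
    ≤hi {t} h = ≤-floor A2≥1 (by (gap (sq≤⇒≤isqrt (sq≤D t h))) (eq t A2 B s))
      where
      eq : ∀ t A B s → s - (t * A - B) ≡ B + s - t * A
      eq = solve-∀

    -- The witness t₀ forces D ≥ 0. For negative D the root defaults to 0 and the two bounds say
    -- nothing.
    between : ∀ {t₀ t} → N ≤ (X + t₀ * dx) * (Y - t₀ * dy) →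
              quadLo N X Y dx dy ≤ t → t ≤ quadHi N X Y dx dy →
              N ≤ (X + t * dx) * (Y - t * dy)
    between {t₀} {t} h₀ l u = ungap (NN-cancel 4A≥1 (subst NN (discriminant t) (gap sq)))
      where
      eq₀ : ∀ t A B s → B + s - t * A ≡ s - (t * A - B)
      eq₀ = solve-∀
      eq₁ : ∀ t f → t - (+ 0 - f) ≡ f - (+ 0 - t)
      eq₁ = solve-∀
      eq₂ : ∀ t A B s → s - B - (+ 0 - t) * A ≡ s - - (t * A - B)
      eq₂ = solve-∀
      sq : z t * z t ≤ D
      sq = ≤isqrt⇒sq≤ (≤-trans (NN-sq (z t₀)) (sq≤D t₀ h₀))
             (by (gap (floor-≤ A2≥1 u)) (eq₀ t A2 B s))
             (by (gap (floor-≤ {+ 0 - t} A2≥1 (by (gap l) (eq₁ t (floorDiv (s - B) A2))))) (eq₂ t A2 B s))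

-- Convexity of the region under the product constraint

am-gm : ∀ {P Q M} → NN P → NN Q → M * M + + 1 ≤ + 4 * (P * Q) → M + + 1 ≤ P + Q
am-gm {P} {Q} {M} P≥0 Q≥0 h with ≤-or-> (M + + 1) (P + Q)
... | inj₁ p = p
... | inj₂ p = ⊥-elim (absurd
      (gap h ⊕ NN-sq (P - Q) ⊕ (gap p) ⊗ (gap p ⊕ (P≥0 ⊕ Q≥0) ⊕ (P≥0 ⊕ Q≥0))) (eq P Q M))
  where
  eq : ∀ P Q M → + 4 * (P * Q) - (M * M + + 1) + (P - Q) * (P - Q)
                 + (M + + 1 - (P + Q + + 1)) * (M + + 1 - (P + Q + + 1) + (P + Q) + (P + Q)) ≡ - (+ 1)
  eq = solve-∀

cross-≥ : ∀ {x₁ y₁ x₂ y₂ N} → + 1 ≤ N → NN x₁ → NN y₁ → NN x₂ → NN y₂ →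
          N ≤ x₁ * y₁ → N ≤ x₂ * y₂ → + 2 * N ≤ x₁ * y₂ + x₂ * y₁
cross-≥ {x₁} {y₁} {x₂} {y₂} {N} N≥1 x₁≥0 y₁≥0 x₂≥0 y₂≥0 h₁ h₂ =
  subst (_≤ x₁ * y₂ + x₂ * y₁) (eq₀ N)
    -- The strict form of `am-gm` at M = 2N - 1 gives the bound 2N: (2N - 1)² + 1 ≤ 4N² ≤ 4
    -- x₁y₁x₂y₂.
    (am-gm {M = + 2 * N - + 1} (x₁≥0 ⊗ y₂≥0) (x₂≥0 ⊗ y₁≥0)
      (by (four ⊗ (gap h₁ ⊗ (x₂≥0 ⊗ y₂≥0)) ⊕ four ⊗ (N≥0 ⊗ gap h₂) ⊕ four ⊗ gap N≥1 ⊕ +≤+ (ℕ.z≤n {2}))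
          (eq x₁ y₁ x₂ y₂ N)))
  where
  N≥0 : NN N
  N≥0 = ≤-trans (+≤+ ℕ.z≤n) N≥1
  four : NN (+ 4)
  four = +≤+ ℕ.z≤n
  eq₀ : ∀ N → + 2 * N - + 1 + + 1 ≡ + 2 * N
  eq₀ = solve-∀
  eq : ∀ x₁ y₁ x₂ y₂ N →
       + 4 * ((x₁ * y₁ - N) * (x₂ * y₂)) + + 4 * (N * (x₂ * y₂ - N)) + + 4 * (N - + 1) + + 2
       ≡ + 4 * (x₁ * y₂ * (x₂ * y₁)) - ((+ 2 * N - + 1) * (+ 2 * N - + 1) + + 1)
  eq = solve-∀

-- Expand W²(xy - n): membership controls the square terms and `cross-≥` the mixed ones. Integer
-- weights avoid division; the total weight W is cancelled twice at the end.
InH-convex : ∀ {n x₀ y₀ x₁ y₁ x₂ y₂ w₀ w₁ w₂ x y} → + 1 ≤ + n →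
  InH n (x₀ , y₀) → InH n (x₁ , y₁) → InH n (x₂ , y₂) →
  NN w₀ → NN w₁ → NN w₂ → + 1 ≤ w₀ + w₁ + w₂ →
  (w₀ + w₁ + w₂) * x ≡ w₀ * x₀ + w₁ * x₁ + w₂ * x₂ →
  (w₀ + w₁ + w₂) * y ≡ w₀ * y₀ + w₁ * y₁ + w₂ * y₂ →
  InH n (x , y)
InH-convex {n} {x₀} {y₀} {x₁} {y₁} {x₂} {y₂} {w₀} {w₁} {w₂} {x} {y} n≥1
  (x₀≥0 , y₀≥0 , h₀) (x₁≥0 , y₁≥0 , h₁) (x₂≥0 , y₂≥0 , h₂) w₀≥0 w₁≥0 w₂≥0 W≥1 ex ey =
    NN-cancel W≥1 (subst NN (sym ex) (w₀≥0 ⊗ x₀≥0 ⊕ w₁≥0 ⊗ x₁≥0 ⊕ w₂≥0 ⊗ x₂≥0))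
  , NN-cancel W≥1 (subst NN (sym ey) (w₀≥0 ⊗ y₀≥0 ⊕ w₁≥0 ⊗ y₁≥0 ⊕ w₂≥0 ⊗ y₂≥0))
  , ungap (NN-cancel W≥1 (NN-cancel W≥1 (subst NN
      (trans (eq (+ n) x₀ y₀ x₁ y₁ x₂ y₂ w₀ w₁ w₂)
        (trans (cong₂ (λ a b → a * b - W * W * + n) (sym ex) (sym ey)) (eq′ W x y (+ n))))
      (w₀≥0 ⊗ w₀≥0 ⊗ gap h₀ ⊕ w₁≥0 ⊗ w₁≥0 ⊗ gap h₁ ⊕ w₂≥0 ⊗ w₂≥0 ⊗ gap h₂
        ⊕ w₀≥0 ⊗ w₁≥0 ⊗ gap (cross-≥ n≥1 x₀≥0 y₀≥0 x₁≥0 y₁≥0 h₀ h₁)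
        ⊕ w₀≥0 ⊗ w₂≥0 ⊗ gap (cross-≥ n≥1 x₀≥0 y₀≥0 x₂≥0 y₂≥0 h₀ h₂)
        ⊕ w₁≥0 ⊗ w₂≥0 ⊗ gap (cross-≥ n≥1 x₁≥0 y₁≥0 x₂≥0 y₂≥0 h₁ h₂)))))
  where
  W = w₀ + w₁ + w₂
  eq : ∀ N x₀ y₀ x₁ y₁ x₂ y₂ w₀ w₁ w₂ →
       w₀ * w₀ * (x₀ * y₀ - N) + w₁ * w₁ * (x₁ * y₁ - N) + w₂ * w₂ * (x₂ * y₂ - N)
         + w₀ * w₁ * (x₀ * y₁ + x₁ * y₀ - + 2 * N)
         + w₀ * w₂ * (x₀ * y₂ + x₂ * y₀ - + 2 * N)
         + w₁ * w₂ * (x₁ * y₂ + x₂ * y₁ - + 2 * N)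
       ≡ (w₀ * x₀ + w₁ * x₁ + w₂ * x₂) * (w₀ * y₀ + w₁ * y₁ + w₂ * y₂)
         - (w₀ + w₁ + w₂) * (w₀ + w₁ + w₂) * N
  eq = solve-∀
  eq′ : ∀ W x y N → W * x * (W * y) - W * W * N ≡ W * (W * (x * y - N))
  eq′ = solve-∀

-- The rational convex hull

ℚ-ring : ACR.AlmostCommutativeRing 0ℓ 0ℓ
ℚ-ring = ACR.fromCommutativeRing ℚₚ.+-*-commutativeRing isZero
  where
  isZero : ∀ x → Maybe (0ℚ ≡ x)
  isZero x with 0ℚ ℚₚ.≟ x
  ... | yes e = just e
  ... | no _  = nothing

ι : ℤ → ℚ
ι x = x ℚ./ 1

toℚᵘ-ι : ∀ x → ℚ.toℚᵘ (ι x) ℚᵘ.≃ mkℚᵘ x 0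
toℚᵘ-ι x = ℚₚ.toℚᵘ-fromℚᵘ (mkℚᵘ x 0)

ι-+ : ∀ x y → ι (x ℤ.+ y) ≡ ι x ℚ.+ ι y
ι-+ x y = ℚₚ.toℚᵘ-injective (ℚᵘₚ.≃-trans (toℚᵘ-ι (x ℤ.+ y)) (ℚᵘₚ.≃-trans (*≡* (eq x y))
  (ℚᵘₚ.≃-sym (ℚᵘₚ.≃-trans (ℚₚ.toℚᵘ-homo-+ (ι x) (ι y)) (ℚᵘₚ.+-cong (toℚᵘ-ι x) (toℚᵘ-ι y))))))
  where
  eq : ∀ x y → (x ℤ.+ y) ℤ.* + 1 ≡ (x ℤ.* + 1 ℤ.+ y ℤ.* + 1) ℤ.* + 1
  eq = solve-∀

ι-* : ∀ x y → ι (x ℤ.* y) ≡ ι x ℚ.* ι y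
ι-* x y = ℚₚ.toℚᵘ-injective (ℚᵘₚ.≃-trans (toℚᵘ-ι (x ℤ.* y)) (ℚᵘₚ.≃-trans (*≡* refl)
  (ℚᵘₚ.≃-sym (ℚᵘₚ.≃-trans (ℚₚ.toℚᵘ-homo-* (ι x) (ι y)) (ℚᵘₚ.*-cong (toℚᵘ-ι x) (toℚᵘ-ι y))))))

ι-injective : ∀ {x y} → ι x ≡ ι y → x ≡ y
ι-injective {x} {y} e with ℚᵘₚ.≃-trans (ℚᵘₚ.≃-sym (toℚᵘ-ι x)) (ℚᵘₚ.≃-trans (ℚᵘₚ.≃-reflexive (cong ℚ.toℚᵘ e)) (toℚᵘ-ι y))
... | *≡* h = trans (sym (ℤₚ.*-identityʳ x)) (trans h (ℤₚ.*-identityʳ y))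

ι-mono-≤ : ∀ {x y} → x ℤ.≤ y → ι x ℚ.≤ ι y
ι-mono-≤ {x} {y} h = ℚₚ.toℚᵘ-cancel-≤ (ℚᵘₚ.≤-respˡ-≃ (ℚᵘₚ.≃-sym (toℚᵘ-ι x)) (ℚᵘₚ.≤-respʳ-≃ (ℚᵘₚ.≃-sym (toℚᵘ-ι y))
  (*≤* (subst₂ ℤ._≤_ (sym (ℤₚ.*-identityʳ x)) (sym (ℤₚ.*-identityʳ y)) h))))

ι-cancel-≤ : ∀ {x y} → ι x ℚ.≤ ι y → x ℤ.≤ y
ι-cancel-≤ {x} {y} h with ℚᵘₚ.≤-respˡ-≃ (toℚᵘ-ι x) (ℚᵘₚ.≤-respʳ-≃ (toℚᵘ-ι y) (ℚₚ.toℚᵘ-mono-≤ h))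
... | *≤* k = subst₂ ℤ._≤_ (ℤₚ.*-identityʳ x) (ℤₚ.*-identityʳ y) k

NNℚ : ℚ → Set
NNℚ e = 0ℚ ℚ.≤ e

infixl 6 _⊞_
infixl 7 _⊠_

_⊞_ : ∀ {a b} → NNℚ a → NNℚ b → NNℚ (a ℚ.+ b)
_⊞_ = ℚₚ.+-mono-≤

_⊠_ : ∀ {a b} → NNℚ a → NNℚ b → NNℚ (a ℚ.* b)
_⊠_ {a} {b} ha hb = ℚₚ.nonNegative⁻¹ (a ℚ.* b) {{ℚₚ.nonNeg*nonNeg⇒nonNeg a {{ℚ.nonNegative ha}} b {{ℚ.nonNegative hb}}}}

gapℚ : ∀ {a b} → a ℚ.≤ b → NNℚ (b ℚ.- a)
gapℚ {a} {b} h = subst (ℚ._≤ b ℚ.- a) (ℚₚ.+-inverseʳ a) (ℚₚ.+-monoˡ-≤ (ℚ.- a) h)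

byℚ : ∀ {e a b} → NNℚ e → e ≡ b ℚ.- a → a ℚ.≤ b
byℚ {e} {a} {b} h eq = subst₂ ℚ._≤_ (ℚₚ.+-identityʳ a) (trans (cong (a ℚ.+_) eq) (cancel a b)) (ℚₚ.+-monoʳ-≤ a h)
  where
  cancel : ∀ a b → a ℚ.+ (b ℚ.- a) ≡ b
  cancel = RS.solve-∀ ℚ-ring

*-cancel-0 : ∀ {t g} → 0ℚ ℚ.< t → t ℚ.* g ≡ 0ℚ → g ≡ 0ℚ
*-cancel-0 {t} {g} t>0 e = ℚₚ.≤-antisym
    (ℚₚ.*-cancelˡ-≤-pos t {{ℚ.positive t>0}} (ℚₚ.≤-reflexive (trans e (sym (ℚₚ.*-zeroʳ t)))))
    (ℚₚ.*-cancelˡ-≤-pos t {{ℚ.positive t>0}} (ℚₚ.≤-reflexive (trans (ℚₚ.*-zeroʳ t) (sym e))))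

0≤1 : NNℚ 1ℚ
0≤1 = ι-mono-≤ {+ 0} {+ 1} (+≤+ ℕ.z≤n)

0<1 : 0ℚ ℚ.< 1ℚ
0<1 = ℚₚ.positive⁻¹ 1ℚ

Points : ℕ → List (ℚ × (ℤ × ℤ)) → Set
Points n = All (λ wp → (0ℚ ℚ.≤ proj₁ wp) × InH n (proj₂ wp))

comb-≥ : ∀ {n} α β γ → (∀ x y → InH n (x , y) → γ ℤ.≤ α ℤ.* x ℤ.+ β ℤ.* y) →
         ∀ l → Points n l → ι γ ℚ.* weightSum l ℚ.≤ ι α ℚ.* combX l ℚ.+ ι β ℚ.* combY l
comb-≥ {n} α β γ bound [] [] = ℚₚ.≤-reflexive (eq (ι α) (ι β) (ι γ))
  where
  eq : ∀ a b c → c ℚ.* 0ℚ ≡ a ℚ.* 0ℚ ℚ.+ b ℚ.* 0ℚ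
  eq = RS.solve-∀ ℚ-ring
comb-≥ {n} α β γ bound ((w , (x , y)) ∷ l) ((w≥0 , q∈H) ∷ ps) =
  byℚ (w≥0 ⊠ gapℚ head ⊞ gapℚ (comb-≥ α β γ bound l ps))
      (eq (ι α) (ι β) (ι γ) w (ι x) (ι y) (weightSum l) (combX l) (combY l))
  where
  head : ι γ ℚ.≤ ι α ℚ.* ι x ℚ.+ ι β ℚ.* ι y
  head = subst (ι γ ℚ.≤_) (trans (ι-+ (α ℤ.* x) (β ℤ.* y)) (cong₂ ℚ._+_ (ι-* α x) (ι-* β y)))
           (ι-mono-≤ (bound x y q∈H))
  eq : ∀ a b c w x y W X Y →
       w ℚ.* (a ℚ.* x ℚ.+ b ℚ.* y ℚ.- c) ℚ.+ (a ℚ.* X ℚ.+ b ℚ.* Y ℚ.- c ℚ.* W)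
       ≡ a ℚ.* (w ℚ.* x ℚ.+ X) ℚ.+ b ℚ.* (w ℚ.* y ℚ.+ Y) ℚ.- c ℚ.* (w ℚ.+ W)
  eq = RS.solve-∀ ℚ-ring

-- A half-plane containing the lattice points of H contains their hull. Every later use of a
-- membership in the hull goes through this fact.
InConv-≥ : ∀ {n} α β γ → (∀ x y → InH n (x , y) → γ ℤ.≤ α ℤ.* x ℤ.+ β ℤ.* y) →
           ∀ a → InConv n a → ι γ ℚ.≤ ι α ℚ.* proj₁ a ℚ.+ ι β ℚ.* proj₂ a
InConv-≥ α β γ bound _ (l , ps , eW , refl , refl) =
  subst (ℚ._≤ _) (trans (cong (ι γ ℚ.*_) eW) (ℚₚ.*-identityʳ (ι γ))) (comb-≥ α β γ bound l ps)

InConv-embed-≥ : ∀ {n} α β γ → (∀ x y → InH n (x , y) → γ ℤ.≤ α ℤ.* x ℤ.+ β ℤ.* y) →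
                 ∀ x y → InConv n (embed (x , y)) → γ ℤ.≤ α ℤ.* x ℤ.+ β ℤ.* y
InConv-embed-≥ α β γ bound x y c = ι-cancel-≤ (subst (ι γ ℚ.≤_)
  (sym (trans (ι-+ (α ℤ.* x) (β ℤ.* y)) (cong₂ ℚ._+_ (ι-* α x) (ι-* β y)))) (InConv-≥ α β γ bound _ c))

InH⇒InConv : ∀ {n} q → InH n q → InConv n (embed q)
InH⇒InConv (x , y) h = (1ℚ , (x , y)) ∷ [] , (0≤1 , h) ∷ [] , refl , eq (ι x) , eq (ι y)
  where
  eq : ∀ a → 1ℚ ℚ.* a ℚ.+ 0ℚ ≡ a
  eq = RS.solve-∀ ℚ-ring

-- Both coordinates of a minimising point are recovered from the values of the
-- two functionals αx + βy and M(αx + βy) − x.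
minimiser⇒vertex : ∀ {n} px py α β M → InH n (px , py) → + 1 ℤ.≤ β →
  (∀ x y → InH n (x , y) → α ℤ.* px ℤ.+ β ℤ.* py ℤ.≤ α ℤ.* x ℤ.+ β ℤ.* y) →
  (∀ x y → InH n (x , y) →
     (M ℤ.* α ℤ.- + 1) ℤ.* px ℤ.+ M ℤ.* β ℤ.* py ℤ.≤ (M ℤ.* α ℤ.- + 1) ℤ.* x ℤ.+ M ℤ.* β ℤ.* y) →
  IsVertex n (px , py)
minimiser⇒vertex {n} px py α β M p∈H β≥1 min₁ min₂ = InH⇒InConv _ p∈H , extreme
  where
  -- A functional f minimal at p = ta + (1 - t)b is also minimal at a: t(f(a) - f(p)) = -(1 -
  -- t)(f(b) - f(p)) ≤ 0, and t > 0.
  face : ∀ α β → (∀ x y → InH n (x , y) → α ℤ.* px ℤ.+ β ℤ.* py ℤ.≤ α ℤ.* x ℤ.+ β ℤ.* y) →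
         ∀ a b t → InConv n a → InConv n b → 0ℚ ℚ.< t → t ℚ.< 1ℚ →
         ι px ≡ t ℚ.* proj₁ a ℚ.+ (1ℚ ℚ.- t) ℚ.* proj₁ b →
         ι py ≡ t ℚ.* proj₂ a ℚ.+ (1ℚ ℚ.- t) ℚ.* proj₂ b →
         ι α ℚ.* proj₁ a ℚ.+ ι β ℚ.* proj₂ a ≡ ι α ℚ.* ι px ℚ.+ ι β ℚ.* ι py
  face α β min (ax , ay) (bx , by′) t ca cb t>0 t<1 ex ey =
    trans (eq₂ (ι α ℚ.* ax ℚ.+ ι β ℚ.* ay) γ)
      (trans (cong (ℚ._+ γ) (*-cancel-0 t>0 (ℚₚ.≤-antisym ub (ℚₚ.<⇒≤ t>0 ⊠ ga)))) (ℚₚ.+-identityˡ γ))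
    where
    γ = ι α ℚ.* ι px ℚ.+ ι β ℚ.* ι py
    γ-eq : ι (α ℤ.* px ℤ.+ β ℤ.* py) ≡ γ
    γ-eq = trans (ι-+ (α ℤ.* px) (β ℤ.* py)) (cong₂ ℚ._+_ (ι-* α px) (ι-* β py))
    ga : NNℚ (ι α ℚ.* ax ℚ.+ ι β ℚ.* ay ℚ.- γ)
    ga = gapℚ (subst (ℚ._≤ (ι α ℚ.* ax ℚ.+ ι β ℚ.* ay)) γ-eq (InConv-≥ α β _ min _ ca))
    gb : NNℚ (ι α ℚ.* bx ℚ.+ ι β ℚ.* by′ ℚ.- γ)
    gb = gapℚ (subst (ℚ._≤ (ι α ℚ.* bx ℚ.+ ι β ℚ.* by′)) γ-eq (InConv-≥ α β _ min _ cb))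
    eq₂ : ∀ e g → e ≡ e ℚ.- g ℚ.+ g
    eq₂ = RS.solve-∀ ℚ-ring
    eq₁ : ∀ a b t g ax ay bx by →
          (1ℚ ℚ.- t) ℚ.* (a ℚ.* bx ℚ.+ b ℚ.* by ℚ.- g)
          ≡ (a ℚ.* (t ℚ.* ax ℚ.+ (1ℚ ℚ.- t) ℚ.* bx) ℚ.+ b ℚ.* (t ℚ.* ay ℚ.+ (1ℚ ℚ.- t) ℚ.* by)) ℚ.- g
            ℚ.- t ℚ.* (a ℚ.* ax ℚ.+ b ℚ.* ay ℚ.- g)
    eq₁ = RS.solve-∀ ℚ-ring
    eq₃ : ∀ g h → g ℚ.- g ℚ.- h ≡ 0ℚ ℚ.- h
    eq₃ = RS.solve-∀ ℚ-ring
    ub : t ℚ.* (ι α ℚ.* ax ℚ.+ ι β ℚ.* ay ℚ.- γ) ℚ.≤ 0ℚ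
    ub = byℚ (gapℚ (ℚₚ.<⇒≤ t<1) ⊠ gb)
      (trans (eq₁ (ι α) (ι β) t γ ax ay bx by′)
        (trans (cong₂ (λ u v → ι α ℚ.* u ℚ.+ ι β ℚ.* v ℚ.- γ ℚ.- t ℚ.* (ι α ℚ.* ax ℚ.+ ι β ℚ.* ay ℚ.- γ)) (sym ex) (sym ey))
          (eq₃ γ _)))

  only : ∀ a b t → InConv n a → InConv n b → 0ℚ ℚ.< t → t ℚ.< 1ℚ →
         ι px ≡ t ℚ.* proj₁ a ℚ.+ (1ℚ ℚ.- t) ℚ.* proj₁ b →
         ι py ≡ t ℚ.* proj₂ a ℚ.+ (1ℚ ℚ.- t) ℚ.* proj₂ b →
         a ≡ (ι px , ι py)
  only a@(ax , ay) b t ca cb t>0 t<1 ex ey = cong₂ _,_ x-eq (y-eq (*-cancel-0 β>0 βy-eq))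
    where
    f₁ = face α β min₁ a b t ca cb t>0 t<1 ex ey
    f₂ = face (M ℤ.* α ℤ.- + 1) (M ℤ.* β) min₂ a b t ca cb t>0 t<1 ex ey
    ια′ : ι (M ℤ.* α ℤ.- + 1) ≡ ι M ℚ.* ι α ℚ.- 1ℚ
    ια′ = trans (ι-+ (M ℤ.* α) (ℤ.- (+ 1))) (cong (ℚ._- 1ℚ) (ι-* M α))
    read : ∀ M a b x y → M ℚ.* (a ℚ.* x ℚ.+ b ℚ.* y) ℚ.- ((M ℚ.* a ℚ.- 1ℚ) ℚ.* x ℚ.+ M ℚ.* b ℚ.* y) ≡ x
    read = RS.solve-∀ ℚ-ring
    f₂′ : (ι M ℚ.* ι α ℚ.- 1ℚ) ℚ.* ax ℚ.+ ι M ℚ.* ι β ℚ.* ay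
          ≡ (ι M ℚ.* ι α ℚ.- 1ℚ) ℚ.* ι px ℚ.+ ι M ℚ.* ι β ℚ.* ι py
    f₂′ = subst₂ (λ u v → u ℚ.* ax ℚ.+ v ℚ.* ay ≡ u ℚ.* ι px ℚ.+ v ℚ.* ι py) ια′ (ι-* M β) f₂
    x-eq : ax ≡ ι px
    x-eq = trans (sym (read (ι M) (ι α) (ι β) ax ay))
             (trans (cong₂ (λ u v → ι M ℚ.* u ℚ.- v) f₁ f₂′) (read (ι M) (ι α) (ι β) (ι px) (ι py)))
    β>0 : 0ℚ ℚ.< ι β
    β>0 = ℚₚ.<-≤-trans 0<1 (ι-mono-≤ β≥1)
    diff : ∀ a b x y y′ → b ℚ.* (y ℚ.- y′) ≡ a ℚ.* x ℚ.+ b ℚ.* y ℚ.- (a ℚ.* x ℚ.+ b ℚ.* y′)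
    diff = RS.solve-∀ ℚ-ring
    βy-eq : ι β ℚ.* (ay ℚ.- ι py) ≡ 0ℚ
    βy-eq = trans (diff (ι α) (ι β) (ι px) ay (ι py))
      (trans (cong (ℚ._- (ι α ℚ.* ι px ℚ.+ ι β ℚ.* ι py)) (trans (cong (λ u → ι α ℚ.* u ℚ.+ ι β ℚ.* ay) (sym x-eq)) f₁))
        (ℚₚ.+-inverseʳ (ι α ℚ.* ι px ℚ.+ ι β ℚ.* ι py)))
    y-eq : ay ℚ.- ι py ≡ 0ℚ → ay ≡ ι py
    y-eq e = trans (restore ay (ι py)) (trans (cong (ℚ._+ ι py) e) (ℚₚ.+-identityˡ (ι py)))
      where
      restore : ∀ a b → a ≡ a ℚ.- b ℚ.+ b
      restore = RS.solve-∀ ℚ-ring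

  extreme : ∀ (a b : Pt) (t : ℚ) → InConv n a → InConv n b → 0ℚ ℚ.< t → t ℚ.< 1ℚ →
            ι px ≡ t ℚ.* proj₁ a ℚ.+ (1ℚ ℚ.- t) ℚ.* proj₁ b →
            ι py ≡ t ℚ.* proj₂ a ℚ.+ (1ℚ ℚ.- t) ℚ.* proj₂ b → a ≡ b
  extreme a b t ca cb t>0 t<1 ex ey =
    trans (only a b t ca cb t>0 t<1 ex ey)
      (sym (only b a (1ℚ ℚ.- t) cb ca
        (subst (ℚ._< 1ℚ ℚ.- t) (ℚₚ.+-inverseʳ t) (ℚₚ.+-monoˡ-< (ℚ.- t) t<1))
        (ℚₚ.+-monoʳ-< 1ℚ (ℚₚ.neg-antimono-< t>0))
        (trans ex (swap t (proj₁ a) (proj₁ b))) (trans ey (swap t (proj₂ a) (proj₂ b)))))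
    where
    swap : ∀ t a b → t ℚ.* a ℚ.+ (1ℚ ℚ.- t) ℚ.* b ≡ (1ℚ ℚ.- t) ℚ.* b ℚ.+ (1ℚ ℚ.- (1ℚ ℚ.- t)) ℚ.* a
    swap = RS.solve-∀ ℚ-ring

-- Extremality speaks of two points, so the second and third are merged into one hull point b. The
-- parameter is t = w₁ / (w₁ + w₂ + w₃), which lies strictly between 0 and 1 because w₁ and w₂ are
-- positive; then the first point equals b, hence p.
vertex-combination : ∀ {n px py x₁ y₁ x₂ y₂ x₃ y₃} w₁ w₂ w₃ → IsVertex n (px , py) →
  InH n (x₁ , y₁) → InH n (x₂ , y₂) → InH n (x₃ , y₃) →
  + 1 ℤ.≤ w₁ → + 1 ℤ.≤ w₂ → NN w₃ →
  w₁ ℤ.* x₁ ℤ.+ (w₂ ℤ.* x₂ ℤ.+ w₃ ℤ.* x₃) ≡ (w₁ ℤ.+ (w₂ ℤ.+ w₃)) ℤ.* px →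
  w₁ ℤ.* y₁ ℤ.+ (w₂ ℤ.* y₂ ℤ.+ w₃ ℤ.* y₃) ≡ (w₁ ℤ.+ (w₂ ℤ.+ w₃)) ℤ.* py →
  x₁ ≡ px × y₁ ≡ py
vertex-combination {n} {px} {py} {x₁} {y₁} {x₂} {y₂} {x₃} {y₃} w₁ w₂ w₃
  (_ , extreme) h₁ h₂ h₃ w₁≥1 w₂≥1 w₃≥0 ex ey =
    ι-injective (coord ex-t (cong proj₁ a≡b)) , ι-injective (coord ey-t (cong proj₂ a≡b))
  where
  a₁ = ι w₁
  a₂ = ι w₂
  a₃ = ι w₃
  S W : ℚ
  S = a₂ ℚ.+ a₃
  W = a₁ ℚ.+ S
  a₁>0 : 0ℚ ℚ.< a₁
  a₁>0 = ℚₚ.<-≤-trans 0<1 (ι-mono-≤ w₁≥1)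
  a₂>0 : 0ℚ ℚ.< a₂
  a₂>0 = ℚₚ.<-≤-trans 0<1 (ι-mono-≤ w₂≥1)
  a₃≥0 : NNℚ a₃
  a₃≥0 = ι-mono-≤ w₃≥0
  S>0 : 0ℚ ℚ.< S
  S>0 = ℚₚ.+-mono-<-≤ a₂>0 a₃≥0
  W>0 : 0ℚ ℚ.< W
  W>0 = ℚₚ.+-mono-< a₁>0 S>0
  instance
    S-pos : ℚ.Positive S
    S-pos = ℚ.positive S>0
    W-pos : ℚ.Positive W
    W-pos = ℚ.positive W>0
    S-nz : ℚ.NonZero S
    S-nz = ℚₚ.pos⇒nonZero S
    W-nz : ℚ.NonZero W
    W-nz = ℚₚ.pos⇒nonZero W
  i j : ℚ
  i = 1/ S
  j = 1/ W
  i>0 : 0ℚ ℚ.< i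
  i>0 = ℚₚ.positive⁻¹ i {{ℚₚ.1/pos⇒pos S}}
  j>0 : 0ℚ ℚ.< j
  j>0 = ℚₚ.positive⁻¹ j {{ℚₚ.1/pos⇒pos W}}
  iS : i ℚ.* S ≡ 1ℚ
  iS = ℚₚ.*-inverseˡ S
  jW : j ℚ.* W ≡ 1ℚ
  jW = ℚₚ.*-inverseˡ W
  t : ℚ
  t = j ℚ.* a₁
  mix : ℤ → ℤ → ℚ
  -- The bracketing and the trailing `0ℚ` are those of `combX` and `combY`, so the coordinate
  -- equations of `b∈conv` hold by `refl`.
  mix u v = i ℚ.* a₂ ℚ.* ι u ℚ.+ (i ℚ.* a₃ ℚ.* ι v ℚ.+ 0ℚ)
  b : Pt
  b = mix x₂ x₃ , mix y₂ y₃
  b∈conv : InConv n b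
  b∈conv = (i ℚ.* a₂ , (x₂ , y₂)) ∷ (i ℚ.* a₃ , (x₃ , y₃)) ∷ []
         , (ℚₚ.<⇒≤ i>0 ⊠ ℚₚ.<⇒≤ a₂>0 , h₂) ∷ (ℚₚ.<⇒≤ i>0 ⊠ a₃≥0 , h₃) ∷ []
         , trans (eq i a₂ a₃) iS , refl , refl
    where
    eq : ∀ i a b → i ℚ.* a ℚ.+ (i ℚ.* b ℚ.+ 0ℚ) ≡ i ℚ.* (a ℚ.+ b)
    eq = RS.solve-∀ ℚ-ring
  pos-* : ∀ {a b} → 0ℚ ℚ.< a → 0ℚ ℚ.< b → 0ℚ ℚ.< a ℚ.* b
  pos-* {a} {b} a>0 b>0 = ℚₚ.positive⁻¹ (a ℚ.* b) {{ℚₚ.pos*pos⇒pos a {{ℚ.positive a>0}} b {{ℚ.positive b>0}}}}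
  t>0 : 0ℚ ℚ.< t
  t>0 = pos-* j>0 a₁>0
  1-t : 1ℚ ℚ.- t ≡ j ℚ.* S
  1-t = trans (cong (ℚ._- t) (sym jW)) (eq j a₁ S)
    where
    eq : ∀ j a s → j ℚ.* (a ℚ.+ s) ℚ.- j ℚ.* a ≡ j ℚ.* s
    eq = RS.solve-∀ ℚ-ring
  t<1 : t ℚ.< 1ℚ
  t<1 = subst₂ ℚ._<_ (ℚₚ.+-identityʳ t) (trans (cong (t ℚ.+_) (sym 1-t)) (eq t)) (ℚₚ.+-monoʳ-< t (pos-* j>0 S>0))
    where
    eq : ∀ t → t ℚ.+ (1ℚ ℚ.- t) ≡ 1ℚ
    eq = RS.solve-∀ ℚ-ring
  balance : ∀ {u v w z} → w₁ ℤ.* u ℤ.+ (w₂ ℤ.* v ℤ.+ w₃ ℤ.* w) ≡ (w₁ ℤ.+ (w₂ ℤ.+ w₃)) ℤ.* z →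
            ι z ≡ t ℚ.* ι u ℚ.+ (1ℚ ℚ.- t) ℚ.* mix v w
  balance {u} {v} {w} {z} e = begin
    ι z                                                          ≡⟨ ℚₚ.*-identityˡ (ι z) ⟨
    1ℚ ℚ.* ι z                                                   ≡⟨ cong (ℚ._* ι z) jW ⟨
    j ℚ.* W ℚ.* ι z                                              ≡⟨ ℚₚ.*-assoc j W (ι z) ⟩
    j ℚ.* (W ℚ.* ι z)                                            ≡⟨ cong (j ℚ.*_) e′ ⟨
    j ℚ.* (a₁ ℚ.* ι u ℚ.+ (a₂ ℚ.* ι v ℚ.+ a₃ ℚ.* ι w))           ≡⟨ eq₁ j a₁ a₂ a₃ (ι u) (ι v) (ι w) ⟩
    t ℚ.* ι u ℚ.+ j ℚ.* 1ℚ ℚ.* (a₂ ℚ.* ι v ℚ.+ a₃ ℚ.* ι w)       ≡⟨ cong (λ k → t ℚ.* ι u ℚ.+ j ℚ.* k ℚ.* (a₂ ℚ.* ι v ℚ.+ a₃ ℚ.* ι w)) iS ⟨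
    t ℚ.* ι u ℚ.+ j ℚ.* (i ℚ.* S) ℚ.* (a₂ ℚ.* ι v ℚ.+ a₃ ℚ.* ι w) ≡⟨ eq₂ (t ℚ.* ι u) i j S a₂ a₃ (ι v) (ι w) ⟩
    t ℚ.* ι u ℚ.+ j ℚ.* S ℚ.* mix v w                            ≡⟨ cong (λ k → t ℚ.* ι u ℚ.+ k ℚ.* mix v w) 1-t ⟨
    t ℚ.* ι u ℚ.+ (1ℚ ℚ.- t) ℚ.* mix v w                         ∎
    where
    open ≡-Reasoning
    e′ : a₁ ℚ.* ι u ℚ.+ (a₂ ℚ.* ι v ℚ.+ a₃ ℚ.* ι w) ≡ W ℚ.* ι z
    e′ = trans (sym (trans (ι-+ (w₁ ℤ.* u) _) (cong₂ ℚ._+_ (ι-* w₁ u) (trans (ι-+ (w₂ ℤ.* v) _) (cong₂ ℚ._+_ (ι-* w₂ v) (ι-* w₃ w))))))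
           (trans (cong ι e) (trans (ι-* (w₁ ℤ.+ (w₂ ℤ.+ w₃)) z) (cong (ℚ._* ι z) (trans (ι-+ w₁ (w₂ ℤ.+ w₃)) (cong (a₁ ℚ.+_) (ι-+ w₂ w₃))))))
    eq₁ : ∀ j a b c u v w → j ℚ.* (a ℚ.* u ℚ.+ (b ℚ.* v ℚ.+ c ℚ.* w)) ≡ j ℚ.* a ℚ.* u ℚ.+ j ℚ.* 1ℚ ℚ.* (b ℚ.* v ℚ.+ c ℚ.* w)
    eq₁ = RS.solve-∀ ℚ-ring
    eq₂ : ∀ e i j s b c v w → e ℚ.+ j ℚ.* (i ℚ.* s) ℚ.* (b ℚ.* v ℚ.+ c ℚ.* w)
          ≡ e ℚ.+ j ℚ.* s ℚ.* (i ℚ.* b ℚ.* v ℚ.+ (i ℚ.* c ℚ.* w ℚ.+ 0ℚ))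
    eq₂ = RS.solve-∀ ℚ-ring
  ex-t = balance ex
  ey-t = balance ey
  a≡b : embed (x₁ , y₁) ≡ b
  a≡b = extreme (embed (x₁ , y₁)) b t (InH⇒InConv _ h₁) b∈conv t>0 t<1 ex-t ey-t
  coord : ∀ {u z m} → z ≡ t ℚ.* u ℚ.+ (1ℚ ℚ.- t) ℚ.* m → u ≡ m → u ≡ z
  coord {u} e refl = sym (trans e (eq t u))
    where
    eq : ∀ t u → t ℚ.* u ℚ.+ (1ℚ ℚ.- t) ℚ.* u ≡ u
    eq = RS.solve-∀ ℚ-ring

-- Vertices and the lattice search

1≤⇒NN : ∀ {a} → + 1 ≤ a → NN a
1≤⇒NN = ≤-trans (+≤+ ℕ.z≤n)

NN0 : NN (+ 0)
NN0 = +≤+ ℕ.z≤n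

NN1 : NN (+ 1)
NN1 = +≤+ ℕ.z≤n

InH-up : ∀ {n} x y → InH n (x , y) → InH n (x , y + + 1)
InH-up {n} x y (x≥0 , y≥0 , h) = x≥0 , y≥0 ⊕ NN1 , by (gap h ⊕ x≥0) (eq x y (+ n))
  where
  eq : ∀ x y N → x * y - N + x ≡ x * (y + + 1) - N
  eq = solve-∀

vertex⇒NN : ∀ {n} x y → IsVertex n (x , y) → NN x × NN y
vertex⇒NN x y (c , _) =
    subst NN (eq₁ x y) (InConv-embed-≥ (+ 1) (+ 0) (+ 0) (λ x y h → subst NN (sym (eq₁ x y)) (proj₁ h)) x y c)
  , subst NN (eq₂ x y) (InConv-embed-≥ (+ 0) (+ 1) (+ 0) (λ x y h → subst NN (sym (eq₂ x y)) (proj₁ (proj₂ h))) x y c)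
  where
  eq₁ : ∀ x y → + 1 * x + + 0 * y ≡ x
  eq₁ = solve-∀
  eq₂ : ∀ x y → + 0 * x + + 1 * y ≡ y
  eq₂ = solve-∀

-- If 0 < xy < n then AM-GM gives y·a + x·b > 2xy for every (a , b) in H, so a line separates (x , y) from the hull.
vertex⇒InH : ∀ {n} x y → + 1 ≤ + n → IsVertex n (x , y) → InH n (x , y)
vertex⇒InH {n} x y n≥1 (c , _) = 1≤⇒NN x≥1 , 1≤⇒NN y≥1 , xy≥n
  where
  eq₁ : ∀ x y → + 1 * x + + 0 * y ≡ x
  eq₁ = solve-∀
  eq₂ : ∀ x y → + 0 * x + + 1 * y ≡ y
  eq₂ = solve-∀
  x≥1 : + 1 ≤ x
  x≥1 = subst (+ 1 ≤_) (eq₁ x y) (InConv-embed-≥ (+ 1) (+ 0) (+ 1)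
          (λ x y (_ , y≥0 , h) → subst (+ 1 ≤_) (sym (eq₁ x y)) (pos-left n≥1 y≥0 h)) x y c)
  y≥1 : + 1 ≤ y
  y≥1 = subst (+ 1 ≤_) (eq₂ x y) (InConv-embed-≥ (+ 0) (+ 1) (+ 1)
          (λ x y (x≥0 , _ , h) → subst (+ 1 ≤_) (sym (eq₂ x y)) (pos-right n≥1 x≥0 h)) x y c)
  xy≥n : + n ≤ x * y
  xy≥n with ≤-or-> (+ n) (x * y)
  ... | inj₁ h = h
  ... | inj₂ h = ⊥-elim (absurd (gap (InConv-embed-≥ y x (+ 2 * (x * y) + + 1) bound x y c)) (eq x y))
    where
    eq : ∀ x y → y * x + x * y - (+ 2 * (x * y) + + 1) ≡ - (+ 1)
    eq = solve-∀
    cert : ∀ x y a b N → + 4 * (x * y * (a * b - N)) + + 4 * (x * y * (N - (x * y + + 1)))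
                 + + 4 * ((x - + 1) * (y - + 1) + (x - + 1) + (y - + 1)) + + 3
                 ≡ + 4 * (y * a * (x * b)) - (+ 2 * (x * y) * (+ 2 * (x * y)) + + 1)
    cert = solve-∀
    bound : ∀ a b → InH n (a , b) → + 2 * (x * y) + + 1 ≤ y * a + x * b
    bound a b (a≥0 , b≥0 , k) = am-gm {y * a} {x * b} {+ 2 * (x * y)} (1≤⇒NN y≥1 ⊗ a≥0) (1≤⇒NN x≥1 ⊗ b≥0)
      (by (+≤+ (ℕ.z≤n {4}) ⊗ (1≤⇒NN x≥1 ⊗ 1≤⇒NN y≥1 ⊗ gap k)
           ⊕ +≤+ (ℕ.z≤n {4}) ⊗ (1≤⇒NN x≥1 ⊗ 1≤⇒NN y≥1 ⊗ gap h)
           ⊕ +≤+ (ℕ.z≤n {4}) ⊗ (gap x≥1 ⊗ gap y≥1 ⊕ gap x≥1 ⊕ gap y≥1) ⊕ +≤+ (ℕ.z≤n {3}))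
          (cert x y a b (+ n)))

-- Otherwise (x , y) would be the midpoint of its left and right neighbours, the right one lying in
-- H with the left.
vertex⇒left∉H : ∀ {n} x y → IsVertex n (x , y) → ¬ InH n (x - + 1 , y)
vertex⇒left∉H {n} x y vtx l@(x-1≥0 , y≥0 , h) =
  absurd (ℤₚ.≤-reflexive (sym (ℤₚ.i≡j⇒i-j≡0 (proj₁ c)))) (eq₃ x)
  where
  eq : ∀ x y N → (x - + 1) * y - N + y + y ≡ (x + + 1) * y - N
  eq = solve-∀
  eq₀ : ∀ x → x - + 1 + + 2 ≡ x + + 1
  eq₀ = solve-∀
  eq₁ : ∀ x → + 1 * (x - + 1) + (+ 1 * (x + + 1) + + 0 * (x + + 1)) ≡ (+ 1 + (+ 1 + + 0)) * x
  eq₁ = solve-∀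
  eq₂ : ∀ y → + 1 * y + (+ 1 * y + + 0 * y) ≡ (+ 1 + (+ 1 + + 0)) * y
  eq₂ = solve-∀
  eq₃ : ∀ x → x - + 1 - x ≡ - (+ 1)
  eq₃ = solve-∀
  r : InH n (x + + 1 , y)
  r = subst NN (eq₀ x) (x-1≥0 ⊕ +≤+ (ℕ.z≤n {2})) , y≥0 , by (gap h ⊕ y≥0 ⊕ y≥0) (eq x y (+ n))
  c = vertex-combination {n} {x} {y} {x - + 1} {y} {x + + 1} {y} {x + + 1} {y} (+ 1) (+ 1) (+ 0) vtx l r r ≤-refl ≤-refl NN0 (eq₁ x) (eq₂ y)

module Search (n : ℕ) (n≥1 : + 1 ≤ + n) (px py : ℤ) (vtx : IsVertex n (px , py)) where

  p∈H : InH n (px , py)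
  p∈H = vertex⇒InH px py n≥1 vtx

  px≥1 : + 1 ≤ px
  px≥1 = pos-left n≥1 (proj₁ (proj₂ p∈H)) (proj₂ (proj₂ p∈H))

  py≥1 : + 1 ≤ py
  py≥1 = pos-right n≥1 (proj₁ p∈H) (proj₂ (proj₂ p∈H))

  record Next (x y : ℤ) : Set where
    constructor mkNext
    field isNext : IsNextVertex n (px , py) (x , y)

  -- F x y: the displacement (x , −y) from p is feasible.
  F : ℤ → ℤ → Set
  F x y = InH n (px + x , py - y)

  F-intro : ∀ x y → NN x → + n ≤ (px + x) * (py - y) → F x y
  F-intro x y x≥0 h = px+x≥0 , 1≤⇒NN (pos-right n≥1 px+x≥0 h) , h
    where
    px+x≥0 = 1≤⇒NN px≥1 ⊕ x≥0

  -- Otherwise p would be the midpoint of the lattice points just below and above it.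
  ¬F01 : ¬ F (+ 0) (+ 1)
  ¬F01 h = absurd (ℤₚ.≤-reflexive (sym (ℤₚ.i≡j⇒i-j≡0 (proj₂ c)))) (eq₃ py)
    where
    eq₁ : ∀ x → + 1 * (x + + 0) + (+ 1 * x + + 0 * x) ≡ (+ 1 + (+ 1 + + 0)) * x
    eq₁ = solve-∀
    eq₂ : ∀ y → + 1 * (y - + 1) + (+ 1 * (y + + 1) + + 0 * (y + + 1)) ≡ (+ 1 + (+ 1 + + 0)) * y
    eq₂ = solve-∀
    eq₃ : ∀ y → y - + 1 - y ≡ - (+ 1)
    eq₃ = solve-∀
    up = InH-up px py p∈H
    c = vertex-combination {n} {px} {py} {px + + 0} {py - + 1} {px} {py + + 1} {px} {py + + 1}
          (+ 1) (+ 1) (+ 0) vtx h up up ≤-refl ≤-refl NN0 (eq₁ px) (eq₂ py)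

  -- If p_y > n, then p_x (p_y - 1) ≥ n because p_x ≥ 1, against `¬F01`. This turns the bound on the
  -- number of doublings into one in n.
  py≤n : py ≤ + n
  py≤n with ≤-or-> py (+ n)
  ... | inj₁ h = h
  ... | inj₂ h = ⊥-elim (¬F01 (F-intro (+ 0) (+ 1) NN0
        (by (gap px≥1 ⊗ gap py≥1 ⊕ gap h) (eq px py (+ n)))))
    where
    eq : ∀ x y N → (x - + 1) * (y - + 1) + (y - (N + + 1)) ≡ (x + + 0) * (y - + 1) - N
    eq = solve-∀

  -- c = ⌈a/b⌉: the point v + c u lies in the triangle spanned by 0, u and a u + b v.
  level : ∀ a b ux uy vx vy → + 1 ≤ b → F ux uy → F (a * ux + b * vx) (a * uy + b * vy) →
          F (ceilDiv a b * ux + vx) (ceilDiv a b * uy + vy)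
  level a b ux uy vx vy b≥1 fu fq =
    InH-convex {n} {px + (a * ux + b * vx)} {py - (a * uy + b * vy)} {px + ux} {py - uy} {px} {py}
      -- With e = cb - a, which lies in [0 , b), one has 1·(au + bv) + e·u + (b - 1 - e)·0 = b(cu +
      -- v), and the weights sum to b.
      {+ 1} {e} {b - + 1 - e} {px + (c * ux + vx)} {py - (c * uy + vy)}
      n≥1 fq fu p∈H NN1 (gap (≤-ceil* {a} {b} b≥1)) e<b (subst (+ 1 ≤_) (eqW b e) b≥1)
      (eqx px a b ux vx c) (eqy py a b uy vy c)
    where
    c = ceilDiv a b
    e = c * b - a
    eqW : ∀ b e → b ≡ + 1 + e + (b - + 1 - e)
    eqW = solve-∀
    eqx : ∀ p a b u v c → (+ 1 + (c * b - a) + (b - + 1 - (c * b - a))) * (p + (c * u + v))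
          ≡ + 1 * (p + (a * u + b * v)) + (c * b - a) * (p + u) + (b - + 1 - (c * b - a)) * p
    eqx = solve-∀
    eqy : ∀ p a b u v c → (+ 1 + (c * b - a) + (b - + 1 - (c * b - a))) * (p - (c * u + v))
          ≡ + 1 * (p - (a * u + b * v)) + (c * b - a) * (p - u) + (b - + 1 - (c * b - a)) * p
    eqy = solve-∀
    e<b : NN (b - + 1 - e)
    e<b with ≤-or-> e (b - + 1)
    ... | inj₁ h = gap h
    ... | inj₂ h = ⊥-elim (absurd (gap (ceil-≤ {c - + 1} {a} {b} b≥1 (by (gap h) (eq₁ a b c)))) (eq₂ c))
      where
      eq₁ : ∀ a b c → c * b - a - (b - + 1 + + 1) ≡ (c - + 1) * b - a
      eq₁ = solve-∀
      eq₂ : ∀ c → c - + 1 - c ≡ - (+ 1)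
      eq₂ = solve-∀

  -- The field below-v says that every feasible displacement to the right is less steep than v.
  record Cone (ux uy vx vy : ℤ) : Set where
    field
      ux≥1 : + 1 ≤ ux
      uy≥1 : + 1 ≤ uy
      vx≥1 : + 1 ≤ vx
      vy≥1 : + 1 ≤ vy
      det  : ux * vy - uy * vx ≡ + 1
      fu   : F ux uy
      below-v : ∀ x y → + 1 ≤ x → F x y → + 1 ≤ x * vy - y * vx

    ¬fv : ¬ F vx vy
    ¬fv f = absurd (gap (below-v vx vy vx≥1 f)) (eq vx vy)
      where
      eq : ∀ x y → x * y - y * x - + 1 ≡ - (+ 1)
      eq = solve-∀

    -- Cramer's rule with determinant 1: a = x vy - y vx and b = ux y - uy x are the integer
    -- coordinates of (x , y) in the basis u, v. So `below-v` says a ≥ 1, and b ≥ 1 means steeper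
    -- than u.
    expand-x : ∀ x y → (x * vy - y * vx) * ux + (ux * y - uy * x) * vx ≡ x
    expand-x x y = trans (eq ux uy vx vy x y) (trans (cong (_* x) det) (ℤₚ.*-identityˡ x))
      where
      eq : ∀ ux uy vx vy x y → (x * vy - y * vx) * ux + (ux * y - uy * x) * vx ≡ (ux * vy - uy * vx) * x
      eq = solve-∀

    expand-y : ∀ x y → (x * vy - y * vx) * uy + (ux * y - uy * x) * vy ≡ y
    expand-y x y = trans (eq ux uy vx vy x y) (trans (cong (_* y) det) (ℤₚ.*-identityˡ y))
      where
      eq : ∀ ux uy vx vy x y → (x * vy - y * vx) * uy + (ux * y - uy * x) * vy ≡ (ux * vy - uy * vx) * y
      eq = solve-∀

    level-cone : ∀ x y → F x y → + 1 ≤ ux * y - uy * x →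
      F (ceilDiv (x * vy - y * vx) (ux * y - uy * x) * ux + vx)
        (ceilDiv (x * vy - y * vx) (ux * y - uy * x) * uy + vy)
    level-cone x y f b≥1 = level (x * vy - y * vx) (ux * y - uy * x) ux uy vx vy b≥1 fu
      (subst₂ F (sym (expand-x x y)) (sym (expand-y x y)) f)

  shift : ∀ x y t dx dy → (px + x + t * dx) * (py - y - t * dy) ≡ (px + (x + t * dx)) * (py - (y + t * dy))
  shift = eq px py
    where
    eq : ∀ px py x y t dx dy → (px + x + t * dx) * (py - y - t * dy) ≡ (px + (x + t * dx)) * (py - (y + t * dy))
    eq = solve-∀

  shift′ : ∀ x y t dx dy → (px + x + t * dx) * (py - y - t * dy) ≡ (px + (t * dx + x)) * (py - (t * dy + y))
  shift′ = eq px py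
    where
    eq : ∀ px py x y t dx dy → (px + x + t * dx) * (py - y - t * dy) ≡ (px + (t * dx + x)) * (py - (t * dy + y))
    eq = solve-∀

  module Slide {ux uy vx vy : ℤ} (cone : Cone ux uy vx vy) where
    open Cone cone
    private
      j = quadHi (+ n) (px + ux) (py - uy) vx vy
      module Q = Quad (+ n) (px + ux) (py - uy) vx vy vx≥1 vy≥1
      at0 : + n ≤ (px + ux + + 0 * vx) * (py - uy - + 0 * vy)
      at0 = subst (+ n ≤_) (eq (px + ux) (py - uy) vx vy) (proj₂ (proj₂ fu))
        where
        eq : ∀ X Y x y → X * Y ≡ (X + + 0 * x) * (Y - + 0 * y)
        eq = solve-∀
      j≥0 : NN j
      j≥0 = Q.≤hi {+ 0} at0

    slide : Cone (ux + j * vx) (uy + j * vy) vx vy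
    slide = record
      { ux≥1 = by (gap ux≥1 ⊕ j≥0 ⊗ 1≤⇒NN vx≥1) (eq ux j vx)
      ; uy≥1 = by (gap uy≥1 ⊕ j≥0 ⊗ 1≤⇒NN vy≥1) (eq uy j vy)
      ; vx≥1 = vx≥1
      ; vy≥1 = vy≥1
      ; det  = trans (eq-det ux uy vx vy j) det
      ; fu   = F-intro _ _ (1≤⇒NN ux≥1 ⊕ j≥0 ⊗ 1≤⇒NN vx≥1)
                 (subst (+ n ≤_) (shift ux uy j vx vy)
                   (Q.between {+ 0} {j} at0 (≤-trans (Q.lo≤ {+ 0} at0) j≥0) ≤-refl))
      ; below-v = below-v }
      where
      eq : ∀ u j v → u - + 1 + j * v ≡ u + j * v - + 1
      eq = solve-∀
      eq-det : ∀ ux uy vx vy j → (ux + j * vx) * vy - (uy + j * vy) * vx ≡ ux * vy - uy * vx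
      eq-det = solve-∀

    uy≤slide : uy ≤ uy + j * vy
    uy≤slide = by (j≥0 ⊗ 1≤⇒NN vy≥1) (eq uy (j * vy))
      where
      eq : ∀ u w → w ≡ u + w - u
      eq = solve-∀

    -- The point is written as k u + v at k = 1 for the new u, the form in which `doubling` excludes
    -- k = 1.
    slide-max : ¬ F (+ 1 * (ux + j * vx) + vx) (+ 1 * (uy + j * vy) + vy)
    slide-max (_ , _ , h) = absurd (gap (Q.≤hi {j + + 1} (subst (+ n ≤_) (eq px py ux uy vx vy j) h))) (eq′ j)
      where
      eq : ∀ px py ux uy vx vy j → (px + (+ 1 * (ux + j * vx) + vx)) * (py - (+ 1 * (uy + j * vy) + vy))
           ≡ (px + ux + (j + + 1) * vx) * (py - uy - (j + + 1) * vy)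
      eq = solve-∀
      eq′ : ∀ j → j - (j + + 1) ≡ - (+ 1)
      eq′ = solve-∀

  module Advance {ux uy vx vy : ℤ} (cone : Cone ux uy vx vy) where
    open Cone cone

    k : ℤ
    k = quadLo (+ n) (px + vx) (py - vy) ux uy

    private
      module Q = Quad (+ n) (px + vx) (py - vy) ux uy ux≥1 uy≥1
      on-line : ∀ t → F (t * ux + vx) (t * uy + vy) → + n ≤ (px + vx + t * ux) * (py - vy - t * uy)
      on-line t (_ , _ , h) = subst (+ n ≤_) (sym (shift′ vx vy t ux uy)) h

    k-least : ∀ t → F (t * ux + vx) (t * uy + vy) → k ≤ t
    k-least t f = Q.lo≤ {t} (on-line t f)

    -- The feasible t form an interval from k on. If it met t ≥ 0 while k ≤ 0, it would contain 0,
    -- making v feasible.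
    k≤0⇒none : k ≤ + 0 → ∀ t → NN t → ¬ F (t * ux + vx) (t * uy + vy)
    k≤0⇒none k≤0 t t≥0 f = ¬fv (F-intro vx vy (1≤⇒NN vx≥1)
      (subst (+ n ≤_) (eq (px + vx) (py - vy) ux uy)
        (Q.between {t} {+ 0} (on-line t f) k≤0 (≤-trans t≥0 (Q.≤hi {t} (on-line t f))))))
      where
      eq : ∀ X Y x y → (X + + 0 * x) * (Y - + 0 * y) ≡ X * Y
      eq = solve-∀

    -- If some t on the line is feasible, then k is itself feasible. An infeasible k therefore
    -- reveals a line without feasible lattice points, whatever value the square root took.
    k∉⇒none : ¬ (+ n ≤ (px + (k * ux + vx)) * (py - (k * uy + vy))) →
              ∀ t → NN t → ¬ F (t * ux + vx) (t * uy + vy)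
    k∉⇒none ¬h t t≥0 f = ¬h (subst (+ n ≤_) (shift′ vx vy k ux uy)
      (Q.between {t} {k} (on-line t f) ≤-refl (≤-trans (k-least t f) (Q.≤hi {t} (on-line t f)))))

    module _ (k≥1 : + 1 ≤ k) (h : + n ≤ (px + (k * ux + vx)) * (py - (k * uy + vy))) where

      fk : F (k * ux + vx) (k * uy + vy)
      fk = F-intro _ _ (1≤⇒NN k≥1 ⊗ 1≤⇒NN ux≥1 ⊕ 1≤⇒NN vx≥1) h

      -- The entries are the terms that `advanceCode` produces: first v′ = (ku + v) - u, then u′ =
      -- v′ + u.
      advance : Cone (k * ux + vx - ux + ux) (k * uy + vy - uy + uy) (k * ux + vx - ux) (k * uy + vy - uy)
      advance = record
        { ux≥1 = u′≥1 ux≥1 vx≥1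
        ; uy≥1 = u′≥1 uy≥1 vy≥1
        ; vx≥1 = v′≥1 ux≥1 vx≥1
        ; vy≥1 = v′≥1 uy≥1 vy≥1
        ; det  = trans (eq-det ux uy vx vy k) det
        ; fu   = subst₂ F (eq-u k ux vx) (eq-u k uy vy) fk
        ; below-v = below-v′ }
        where
        eq-u : ∀ k u v → k * u + v ≡ k * u + v - u + u
        eq-u = solve-∀
        eq-det : ∀ ux uy vx vy k →
          (k * ux + vx - ux + ux) * (k * uy + vy - uy) - (k * uy + vy - uy + uy) * (k * ux + vx - ux)
          ≡ ux * vy - uy * vx
        eq-det = solve-∀
        v′≥1 : ∀ {u v} → + 1 ≤ u → + 1 ≤ v → + 1 ≤ k * u + v - u
        v′≥1 {u} {v} u≥1 v≥1 = by (gap k≥1 ⊗ 1≤⇒NN u≥1 ⊕ gap v≥1) (eq k u v)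
          where
          eq : ∀ k u v → (k - + 1) * u + (v - + 1) ≡ k * u + v - u - + 1
          eq = solve-∀
        u′≥1 : ∀ {u v} → + 1 ≤ u → + 1 ≤ v → + 1 ≤ k * u + v - u + u
        u′≥1 {u} {v} u≥1 v≥1 = by (gap (v′≥1 {u} {v} u≥1 v≥1) ⊕ 1≤⇒NN u≥1) (eq (k * u + v - u) u)
          where
          eq : ∀ w u → w - + 1 + u ≡ w + u - + 1
          eq = solve-∀
        -- A feasible (x , y) at least as steep as v′ has a ≤ (k - 1)b, so `level-cone` gives a
        -- feasible point cu + v with c = ⌈a/b⌉ ≤ k - 1, against the minimality of k.
        below-v′ : ∀ x y → + 1 ≤ x → F x y → + 1 ≤ x * (k * uy + vy - uy) - y * (k * ux + vx - ux)
        below-v′ x y x≥1 f with ≤-or-> (+ 1) (x * (k * uy + vy - uy) - y * (k * ux + vx - ux))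
        ... | inj₁ p = p
        ... | inj₂ p = ⊥-elim (absurd (gap (≤-trans (k-least _ (level-cone x y f b≥1)) c≤k-1)) (eq₂ k))
          where
          a = x * vy - y * vx
          b = ux * y - uy * x
          a≤ : a ≤ (k - + 1) * b
          a≤ = by (gap p) (eq ux uy vx vy k x y)
            where
            eq : ∀ ux uy vx vy k x y →
              + 1 - (x * (k * uy + vy - uy) - y * (k * ux + vx - ux) + + 1)
              ≡ (k - + 1) * (ux * y - uy * x) - (x * vy - y * vx)
            eq = solve-∀
          b≥1 : + 1 ≤ b
          b≥1 = pos-right {k - + 1} {b} {a} (below-v x y x≥1 f) (gap k≥1) a≤
          c≤k-1 : ceilDiv a b ≤ k - + 1
          c≤k-1 = ceil-≤ {k - + 1} {a} {b} b≥1 a≤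
          eq₂ : ∀ k → k - + 1 - k ≡ - (+ 1)
          eq₂ = solve-∀

      -- If u + v is infeasible then k ≥ 2, so the vertical extent of u at least doubles.
      doubling : ¬ F (+ 1 * ux + vx) (+ 1 * uy + vy) → + 2 * uy ≤ k * uy + vy - uy + uy
      doubling ¬f with ≤⇒≡⊎1+≤ k≥1
      ... | inj₁ e = ⊥-elim (¬f (subst (λ k → F (k * ux + vx) (k * uy + vy)) (sym e) fk))
      ... | inj₂ k≥2 = by (gap k≥2 ⊗ 1≤⇒NN uy≥1 ⊕ 1≤⇒NN vy≥1) (eq k uy vy)
        where
        eq : ∀ k u v → (k - + 2) * u + v ≡ k * u + v - u + u - + 2 * u
        eq = solve-∀

  module Finish {ux uy vx vy : ℤ} (cone : Cone ux uy vx vy)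
                (none : ∀ t → NN t → ¬ F (t * ux + vx) (t * uy + vy)) where
    open Cone cone

    -- A steeper feasible displacement has b ≥ 1; as a ≥ 1 too, `level-cone` yields a feasible point
    -- cu + v with c ≥ 0, which `none` forbids.
    top : ∀ x y → + 1 ≤ x → F x y → ux * y - uy * x ≤ + 0
    top x y x≥1 f with ≤-or-> (ux * y - uy * x) (+ 0)
    ... | inj₁ h = h
    ... | inj₂ h = ⊥-elim (none _ c≥0 (level-cone x y f h))
      where
      a = x * vy - y * vx
      b = ux * y - uy * x
      c≥0 : NN (ceilDiv a b)
      c≥0 = NN-cancel {b} {ceilDiv a b} h (subst NN (ℤₚ.*-comm (ceilDiv a b) b)
              (≤-trans (1≤⇒NN (below-v x y x≥1 f)) (≤-ceil* {a} {b} h)))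

    m : ℤ
    m = quadHi (+ n) px py ux uy

    private
      module Q = Quad (+ n) px py ux uy ux≥1 uy≥1

      at1 : + n ≤ (px + + 1 * ux) * (py - + 1 * uy)
      at1 = subst (+ n ≤_) (eq px py ux uy) (proj₂ (proj₂ fu))
        where
        eq : ∀ px py x y → (px + x) * (py - y) ≡ (px + + 1 * x) * (py - + 1 * y)
        eq = solve-∀

      m≥1 : + 1 ≤ m
      m≥1 = Q.≤hi {+ 1} at1

      p′x p′y : ℤ
      p′x = px + m * ux
      p′y = py - m * uy

      p′∈H : InH n (p′x , p′y)
      p′∈H = F-intro (m * ux) (m * uy) (1≤⇒NN m≥1 ⊗ 1≤⇒NN ux≥1)
        (Q.between {+ 1} {m} at1 (≤-trans (Q.lo≤ {+ 1} at1) m≥1) ≤-refl)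

      F-of : ∀ x y → InH n (x , y) → F (x - px) (py - y)
      F-of x y = subst₂ (λ a b → InH n (a , b)) (eq₁ px x) (eq₂ py y)
        where
        eq₁ : ∀ p x → x ≡ p + (x - p)
        eq₁ = solve-∀
        eq₂ : ∀ p x → x ≡ p - (p - x)
        eq₂ = solve-∀

      supporting : ∀ x y → InH n (x , y) → uy * px + ux * py ≤ uy * x + ux * y
      supporting x y q∈H with ≤-or-> x px
      ... | inj₂ x>px = by (gap (top (x - px) (py - y) (by (gap x>px) (eq₁ px x)) (F-of x y q∈H))) (eq₂ px py ux uy x y)
        where
        eq₁ : ∀ p x → x - (p + + 1) ≡ x - p - + 1
        eq₁ = solve-∀
        eq₂ : ∀ px py ux uy x y → + 0 - (ux * (py - y) - uy * (x - px)) ≡ uy * x + ux * y - (uy * px + ux * py)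
        eq₂ = solve-∀
      ... | inj₁ x≤px with ≤-or-> (uy * px + ux * py) (uy * x + ux * y)
      ...   | inj₁ h = h
      ...   | inj₂ h = ⊥-elim (absurd (ℤₚ.≤-reflexive (sym (ℤₚ.i≡j⇒i-j≡0 (sym (proj₂ c))))) (eq₃ py))
        where
        -- A point q left of or level with p and below the line would make the segment from q to p +
        -- u pass strictly below p. Then p lies between that crossing and (p_x , p_y + 1); w is the
        -- depth of the crossing times the weight ux + (p_x - x).
        w = uy * px + ux * py - (uy * x + ux * y)
        eq₀ : ∀ a b → a - (b + + 1) ≡ a - b - + 1
        eq₀ = solve-∀
        eq₁ : ∀ px py ux uy x y →
          (uy * px + ux * py - (uy * x + ux * y)) * px + (ux * x + (px - x) * (px + ux))
          ≡ (uy * px + ux * py - (uy * x + ux * y) + (ux + (px - x))) * px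
        eq₁ = solve-∀
        eq₂ : ∀ px py ux uy x y →
          (uy * px + ux * py - (uy * x + ux * y)) * (py + + 1) + (ux * y + (px - x) * (py - uy))
          ≡ (uy * px + ux * py - (uy * x + ux * y) + (ux + (px - x))) * py
        eq₂ = solve-∀
        eq₃ : ∀ y → y - (y + + 1) ≡ - (+ 1)
        eq₃ = solve-∀
        c = vertex-combination {n} {px} {py} {px} {py + + 1} {x} {y} {px + ux} {py - uy} w ux (px - x)
              vtx (InH-up px py p∈H) q∈H fu (by (gap h) (eq₀ (uy * px + ux * py) (uy * x + ux * y))) ux≥1 (gap x≤px)
              (eq₁ px py ux uy x y) (eq₂ px py ux uy x y)

      supporting′ : ∀ x y → InH n (x , y) → uy * p′x + ux * p′y ≤ uy * x + ux * y
      supporting′ x y q∈H = subst (_≤ uy * x + ux * y) (eq px py ux uy m) (supporting x y q∈H)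
        where
        eq : ∀ px py ux uy m → uy * px + ux * py ≡ uy * (px + m * ux) + ux * (py - m * uy)
        eq = solve-∀

      -- Write D for the excess of uy·x + ux·y at a lattice point of H to the right of p′. From y ≥
      -- 0 follows x - p′x ≤ D + K, and D ≥ 1 gives D + K ≤ M D; so this M outweighs the tilt by -x.
      K M : ℤ
      K = ux * p′y
      M = + 1 + K

      K≥0 : NN K
      K≥0 = 1≤⇒NN ux≥1 ⊗ proj₁ (proj₂ p′∈H)

      -- On the line b = 0, so the displacement is a·u with a an integer, and a ≤ m since m is the
      -- largest feasible multiple.
      on-edge : ∀ x y → InH n (x , y) → uy * x + ux * y ≡ uy * p′x + ux * p′y → x ≤ p′x
      on-edge x y q∈H e = by (gap a≤m ⊗ 1≤⇒NN ux≥1) (trans (eq₂ px m a ux) (cong (λ z → px + m * ux - z) (sym x≡)))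
        where
        X = x - px
        Y = py - y
        a = X * vy - Y * vx
        b = ux * Y - uy * X
        b≡0 : b ≡ + 0
        b≡0 = trans (eq px py ux uy x y m) (trans (cong (λ z → uy * (px + m * ux) + ux * (py - m * uy) - z) e) (ℤₚ.+-inverseʳ (uy * p′x + ux * p′y)))
          where
          eq : ∀ px py ux uy x y m → ux * (py - y) - uy * (x - px)
               ≡ uy * (px + m * ux) + ux * (py - m * uy) - (uy * x + ux * y)
          eq = solve-∀
        drop : ∀ v w → a * v + b * w ≡ a * v
        drop v w = trans (cong (λ z → a * v + z * w) b≡0) (eq a v w)
          where
          eq : ∀ a v w → a * v + + 0 * w ≡ a * v
          eq = solve-∀
        x≡ : x ≡ px + a * ux
        x≡ = trans (eq px x) (cong (λ z → px + z) (trans (sym (expand-x X Y)) (drop ux vx)))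
          where
          eq : ∀ p x → x ≡ p + (x - p)
          eq = solve-∀
        y≡ : y ≡ py - a * uy
        y≡ = trans (eq py y) (cong (λ z → py - z) (trans (sym (expand-y X Y)) (drop uy vy)))
          where
          eq : ∀ p x → x ≡ p - (p - x)
          eq = solve-∀
        a≤m : a ≤ m
        a≤m = Q.≤hi {a} (subst₂ (λ u v → + n ≤ u * v) x≡ y≡ (proj₂ (proj₂ q∈H)))
        eq₂ : ∀ p m a u → (m - a) * u ≡ p + m * u - (p + a * u)
        eq₂ = solve-∀

      tilted : ∀ x y → InH n (x , y) →
        (M * uy - + 1) * p′x + M * ux * p′y ≤ (M * uy - + 1) * x + M * ux * y
      tilted x y q∈H with ≤-or-> x p′x
      ... | inj₁ x≤p′x = by ((NN1 ⊕ K≥0) ⊗ gap (supporting′ x y q∈H) ⊕ gap x≤p′x) (eq M ux uy p′x p′y x y)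
        where
        eq : ∀ M ux uy a b x y → M * (uy * x + ux * y - (uy * a + ux * b)) + (a - x)
             ≡ (M * uy - + 1) * x + M * ux * y - ((M * uy - + 1) * a + M * ux * b)
        eq = solve-∀
      ... | inj₂ x>p′x with ≤⇒≡⊎1+≤ (supporting′ x y q∈H)
      ...   | inj₁ e = ⊥-elim (1+≤⇒≰ x>p′x (on-edge x y q∈H (sym e)))
      ...   | inj₂ D≥1 =
        by (gap uy≥1 ⊗ (gap x>p′x ⊕ NN1) ⊕ gap D≥1 ⊗ K≥0 ⊕ 1≤⇒NN ux≥1 ⊗ proj₁ (proj₂ q∈H)) (eq ux uy p′x p′y x y)
        where
        eq : ∀ ux uy a b x y →
             (uy - + 1) * (x - (a + + 1) + + 1) + (uy * x + ux * y - (uy * a + ux * b + + 1)) * (ux * b) + ux * y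
             ≡ ((+ 1 + ux * b) * uy - + 1) * x + (+ 1 + ux * b) * ux * y
               - (((+ 1 + ux * b) * uy - + 1) * a + (+ 1 + ux * b) * ux * b)
        eq = solve-∀

      first : ∀ x y → IsVertex n (x , y) → px < x → p′x ≤ x
      first x y vq px<x with ≤-or-> p′x x
      ... | inj₁ h = h
      ... | inj₂ h = ⊥-elim (ℤₚ.<-irrefl (proj₁ c) px<x)
        where
        q∈H = vertex⇒InH x y n≥1 vq
        px+1≤x : px + + 1 ≤ x
        px+1≤x = subst (_≤ x) (ℤₚ.+-comm (+ 1) px) (ℤₚ.i<j⇒suc[i]≤j px<x)
        eq₀ : ∀ a b → a - (b + + 1) ≡ a - b - + 1
        eq₀ = solve-∀
        -- A vertex q strictly between p and p′ horizontally lies on or above their edge. The first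
        -- two weights give the point of the edge below q; the third, on (x , y + 1), lifts it to q
        -- and vanishes if q is on the edge.
        w₁ = p′x - x
        w₂ = x - px
        w₃ = m * (uy * x + ux * y - (uy * px + ux * py))
        eq₁ : ∀ px py ux uy m x y →
          (px + m * ux - x) * px + ((x - px) * (px + m * ux) + m * (uy * x + ux * y - (uy * px + ux * py)) * x)
          ≡ (px + m * ux - x + (x - px + m * (uy * x + ux * y - (uy * px + ux * py)))) * x
        eq₁ = solve-∀
        eq₂ : ∀ px py ux uy m x y →
          (px + m * ux - x) * py + ((x - px) * (py - m * uy) + m * (uy * x + ux * y - (uy * px + ux * py)) * (y + + 1))
          ≡ (px + m * ux - x + (x - px + m * (uy * x + ux * y - (uy * px + ux * py)))) * y
        eq₂ = solve-∀
        c = vertex-combination {n} {x} {y} {px} {py} {p′x} {p′y} {x} {y + + 1} w₁ w₂ w₃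
              vq p∈H p′∈H (InH-up x y q∈H) (by (gap h) (eq₀ p′x x)) (by (gap px+1≤x) (eq₀ x px))
              (1≤⇒NN m≥1 ⊗ gap (supporting x y q∈H))
              (eq₁ px py ux uy m x y) (eq₂ px py ux uy m x y)

    next : Next (px + m * ux) (py - m * uy)
    next = mkNext (minimiser⇒vertex p′x p′y uy ux M p′∈H ux≥1 supporting′ tilted
         , ℤₚ.suc[i]≤j⇒i<j (by (gap m≥1 ⊗ 1≤⇒NN ux≥1 ⊕ gap ux≥1) (eq px m ux))
         , λ (x , y) → first x y)
      where
      eq : ∀ p m u → (m - + 1) * u + (u - + 1) ≡ p + m * u - (+ 1 + p)
      eq = solve-∀

  -- The two starting bases

  shrink : ∀ b x y → + 1 ≤ b → F (b * x) (b * y) → F x y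
  shrink b x y b≥1 f =
    InH-convex {n} {px + b * x} {py - b * y} {px} {py} {px} {py} {+ 1} {b - + 1} {+ 0} {px + x} {py - y}
      n≥1 f p∈H p∈H NN1 (gap b≥1) NN0 (subst (+ 1 ≤_) (eqW b) b≥1) (eqx px b x) (eqy py b y)
    where
    eqW : ∀ b → b ≡ + 1 + (b - + 1) + + 0
    eqW = solve-∀
    eqx : ∀ p b x → (+ 1 + (b - + 1) + + 0) * (p + x) ≡ + 1 * (p + b * x) + (b - + 1) * p + + 0 * p
    eqx = solve-∀
    eqy : ∀ p b x → (+ 1 + (b - + 1) + + 0) * (p - x) ≡ + 1 * (p - b * x) + (b - + 1) * p + + 0 * p
    eqy = solve-∀

  -- The largest s for which (1 , s) is feasible.
  drop₁ : ℤ
  drop₁ = py - ceilDiv (+ n) (px + + 1)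

  private
    px+1≥1 : + 1 ≤ px + + 1
    px+1≥1 = by (1≤⇒NN px≥1) (eq px)
      where
      eq : ∀ x → x ≡ x + + 1 - + 1
      eq = solve-∀

  start-steep : + 1 ≤ drop₁ → Cone (+ 1) drop₁ (+ 1) (drop₁ + + 1)
  start-steep s≥1 = record
    { ux≥1 = ≤-refl
    ; uy≥1 = s≥1
    ; vx≥1 = ≤-refl
    ; vy≥1 = by (1≤⇒NN s≥1) (eq₁ drop₁)
    ; det  = eq₂ drop₁
    ; fu   = F-intro (+ 1) drop₁ NN1 (subst (+ n ≤_) (eq₃ px py d) (≤-ceil* {+ n} {px + + 1} px+1≥1))
    ; below-v = below-v }
    where
    d = ceilDiv (+ n) (px + + 1)
    eq₁ : ∀ s → s ≡ s + + 1 - + 1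
    eq₁ = solve-∀
    eq₂ : ∀ s → + 1 * (s + + 1) - s * + 1 ≡ + 1
    eq₂ = solve-∀
    eq₃ : ∀ px py d → d * (px + + 1) ≡ (px + + 1) * (py - (py - d))
    eq₃ = solve-∀
    -- If y ≥ x(s + 1) with s = `drop₁`, raising the point to (x , x(s + 1)) keeps it feasible, and
    -- shrinking by x makes (1 , s + 1) feasible, against the ceiling in `drop₁`.
    below-v : ∀ x y → + 1 ≤ x → F x y → + 1 ≤ x * (drop₁ + + 1) - y * + 1
    below-v x y x≥1 (px+x≥0 , _ , h) with ≤-or-> (+ 1) (x * (drop₁ + + 1) - y * + 1)
    ... | inj₁ p = p
    ... | inj₂ p = ⊥-elim (absurd (gap (ceil-≤ {d - + 1} {+ n} {px + + 1} px+1≥1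
            (subst (+ n ≤_) (eq₅ px py d) (proj₂ (proj₂ f₁))))) (eq₆ d))
      where
      eq₄ : ∀ px py s x y N → (px + x) * (py - y) - N + (px + x) * (+ 1 - (x * (s + + 1) - y * + 1 + + 1))
            ≡ (px + x * + 1) * (py - x * (s + + 1)) - N
      eq₄ = solve-∀
      eq₅ : ∀ px py d → (px + + 1) * (py - (py - d + + 1)) ≡ (d - + 1) * (px + + 1)
      eq₅ = solve-∀
      eq₆ : ∀ d → d - + 1 - d ≡ - (+ 1)
      eq₆ = solve-∀
      f₁ : F (+ 1) (drop₁ + + 1)
      f₁ = shrink x (+ 1) (drop₁ + + 1) x≥1
        (F-intro (x * + 1) (x * (drop₁ + + 1)) (1≤⇒NN x≥1 ⊗ NN1)
          (by (gap h ⊕ px+x≥0 ⊗ gap p) (eq₄ px py drop₁ x y (+ n))))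

  -- The least k for which (k , 1) is feasible.
  reach₁ : ℤ
  reach₁ = ceilDiv (+ n) (py - + 1) - px

  start-flat : ¬ (+ 1 ≤ drop₁) → + 2 ≤ py → Cone reach₁ (+ 1) (reach₁ - + 1) (+ 1)
  start-flat ¬s≥1 py≥2 = record
    { ux≥1 = ≤-trans (+≤+ (ℕ.s≤s ℕ.z≤n)) k≥2
    ; uy≥1 = ≤-refl
    ; vx≥1 = by (gap k≥2) (eq₁ reach₁)
    ; vy≥1 = ≤-refl
    ; det  = eq₂ reach₁
    ; fu   = F-intro reach₁ (+ 1) (≤-trans (+≤+ ℕ.z≤n) k≥2) (subst (+ n ≤_) (eq₃ px py e) (≤-ceil* {+ n} {py - + 1} py-1≥1))
    ; below-v = below-v }
    where
    e = ceilDiv (+ n) (py - + 1)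
    d = ceilDiv (+ n) (px + + 1)
    py-1≥1 : + 1 ≤ py - + 1
    py-1≥1 = by (gap py≥2) (eq py)
      where
      eq : ∀ y → y - + 2 ≡ y - + 1 - + 1
      eq = solve-∀
    eq₁ : ∀ k → k - + 2 ≡ k - + 1 - + 1
    eq₁ = solve-∀
    eq₂ : ∀ k → k * + 1 - + 1 * (k - + 1) ≡ + 1
    eq₂ = solve-∀
    eq₃ : ∀ px py e → e * (py - + 1) ≡ (px + (e - px)) * (py - + 1)
    eq₃ = solve-∀
    -- If `reach₁` were at most 1, then (1 , 1) would be feasible and `drop₁` at least 1.
    k≥2 : + 2 ≤ reach₁
    k≥2 with ≤-or-> (+ 2) reach₁
    ... | inj₁ p = p
    ... | inj₂ p = ⊥-elim (¬s≥1 (by (gap (ceil-≤ {py - + 1} {+ n} {px + + 1} px+1≥1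
            (by (gap (≤-ceil* {+ n} {py - + 1} py-1≥1) ⊕ gap p ⊗ 1≤⇒NN py-1≥1) (eq px py e (+ n))))) (eq′ py d)))
      where
      eq : ∀ px py e N → e * (py - + 1) - N + (+ 2 - (e - px + + 1)) * (py - + 1) ≡ (py - + 1) * (px + + 1) - N
      eq = solve-∀
      eq′ : ∀ y d → y - + 1 - d ≡ y - d - + 1
      eq′ = solve-∀
    -- The mirror image of the steep case: move right to (y(k - 1) , y), with k = `reach₁`, and
    -- shrink by y.
    below-v : ∀ x y → + 1 ≤ x → F x y → + 1 ≤ x * + 1 - y * (reach₁ - + 1)
    below-v x y x≥1 (_ , py-y≥0 , h) with ≤-or-> (+ 1) (x * + 1 - y * (reach₁ - + 1))
    ... | inj₁ p = p
    ... | inj₂ p = ⊥-elim (absurd (gap (ceil-≤ {e - + 1} {+ n} {py - + 1} py-1≥1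
            (subst (+ n ≤_) (eq₅ px py e) (proj₂ (proj₂ f₁))))) (eq₆ e))
      where
      k-1≥0 : NN (reach₁ - + 1)
      k-1≥0 = 1≤⇒NN (by (gap k≥2) (eq₁ reach₁))
      x≤ : x ≤ y * (reach₁ - + 1)
      x≤ = by (gap p) (eq x (y * (reach₁ - + 1)))
        where
        eq : ∀ x z → + 1 - (x * + 1 - z + + 1) ≡ z - x
        eq = solve-∀
      y≥1 : + 1 ≤ y
      y≥1 = pos-left {y} {reach₁ - + 1} {x} x≥1 k-1≥0 x≤
      eq₄ : ∀ px py k x y N → (px + x) * (py - y) - N + (y * (k - + 1) - x) * (py - y)
            ≡ (px + y * (k - + 1)) * (py - y * + 1) - N
      eq₄ = solve-∀
      eq₅ : ∀ px py e → (px + (e - px - + 1)) * (py - + 1) ≡ (e - + 1) * (py - + 1)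
      eq₅ = solve-∀
      eq₆ : ∀ e → e - + 1 - e ≡ - (+ 1)
      eq₆ = solve-∀
      f₁ : F (reach₁ - + 1) (+ 1)
      f₁ = shrink y (reach₁ - + 1) (+ 1) y≥1
        (F-intro (y * (reach₁ - + 1)) (y * + 1) (1≤⇒NN y≥1 ⊗ k-1≥0)
          (by (gap h ⊕ gap x≤ ⊗ py-y≥0) (eq₄ px py reach₁ x y (+ n))))

  -- If p_y ≤ 1, a vertex q further right has height at least p_y, so its left neighbour still
  -- dominates p and lies in H, against `vertex⇒left∉H`.
  next⇒py≥2 : ∀ x y → IsVertex n (x , y) → px < x → + 2 ≤ py
  next⇒py≥2 x y vq px<x with ≤-or-> (+ 2) py
  ... | inj₁ h = h
  ... | inj₂ h = ⊥-elim (vertex⇒left∉H x y vq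
        (≤-trans (1≤⇒NN px≥1) (by (gap px+1≤x) (eq₁ px x)) , 1≤⇒NN y≥1
        , by (gap (proj₂ (proj₂ p∈H)) ⊕ gap px+1≤x ⊗ 1≤⇒NN y≥1 ⊕ 1≤⇒NN px≥1 ⊗ (gap y≥1 ⊕ gap h)) (eq px py x y (+ n))))
    where
    q∈H = vertex⇒InH x y n≥1 vq
    y≥1 : + 1 ≤ y
    y≥1 = pos-right n≥1 (proj₁ q∈H) (proj₂ (proj₂ q∈H))
    px+1≤x : px + + 1 ≤ x
    px+1≤x = subst (_≤ x) (ℤₚ.+-comm (+ 1) px) (ℤₚ.i<j⇒suc[i]≤j px<x)
    eq₁ : ∀ p x → x - (p + + 1) ≡ x - + 1 - p
    eq₁ = solve-∀
    eq : ∀ px py x y N → px * py - N + (x - (px + + 1)) * y + px * (y - + 1 + (+ 2 - (py + + 1))) ≡ (x - + 1) * y - N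
    eq = solve-∀

-- The program

Reg : Set
Reg = Fin 14

Store : Set
Store = Vec ℤ 14

data SInstr : Set where
  constˢ : Reg → ℤ → SInstr
  arithˢ : Op → (r a b : Reg) → SInstr
  sqrtˢ  : (r a : Reg) → SInstr

compile : SInstr → Instr
compile (constˢ r c)     = const (toℕ r) c
compile (arithˢ o r a b) = arith o (toℕ r) (toℕ a) (toℕ b)
compile (sqrtˢ r a)      = sqrt (toℕ r) (toℕ a)

exec₁ : SInstr → Store → Store
exec₁ (constˢ r c) V     = V [ r ]≔ c
exec₁ (arithˢ o r a b) V = V [ r ]≔ applyOp o (lookup V a) (lookup V b)
exec₁ (sqrtˢ r a) V      = V [ r ]≔ isqrtℤ (lookup V a)

exec : List SInstr → Store → Store
exec [] V       = V
exec (i ∷ is) V = exec is (exec₁ i V)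

Matches : Regs → Store → Set
Matches R V = ∀ r → R (toℕ r) ≡ lookup V r

update-matches : ∀ {R V} r c → Matches R V → Matches (update R (toℕ r) c) (V [ r ]≔ c)
update-matches {R} {V} r c RV i with toℕ i ℕ.≟ toℕ r
... | yes e with Finₚ.toℕ-injective e
...   | refl = sym (Vecₚ.lookup∘updateAt r V)
update-matches {R} {V} r c RV i | no ne =
  trans (RV i) (sym (Vecₚ.lookup∘updateAt′ i r (λ e → ne (cong toℕ e)) V))

-- Total correctness with an instruction budget

run-mono : ∀ P {R′} t t′ pc R → t ℕ.≤ t′ → run P t pc R ≡ just R′ → run P t′ pc R ≡ just R′
run-mono P (suc t) (suc t′) pc R (ℕ.s≤s le) e with fetch P pc
... | const r c     = run-mono P t t′ (suc pc) _ le e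
... | arith o r a b = run-mono P t t′ (suc pc) _ le e
... | sqrt r a      = run-mono P t t′ (suc pc) _ le e
... | jmp l         = run-mono P t t′ l _ le e
... | halt          = e
... | jle a b l with R a ≤? R b
...   | yes _ = run-mono P t t′ l _ le e
...   | no _  = run-mono P t t′ (suc pc) _ le e

module Hoare (P : Program) (Post : Regs → Set) where

  -- The budget t counts executed instructions, the final halt included. The machine has infinitely
  -- many registers; a store fixes the first 14 and leaves the others arbitrary.
  record Good (t pc : ℕ) (V : Store) : Set where
    field
      outcome : ∀ R → Matches R V → ∃ λ R′ → run P t pc R ≡ just R′ × Post R′

  open Good public

  weaken : ∀ {t t′ pc V} → t ℕ.≤ t′ → Good t pc V → Good t′ pc V
  weaken {t} {t′} {pc} le g .outcome R RV with g .outcome R RV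
  ... | R′ , e , post = R′ , run-mono P t t′ pc R le e , post

  fetches : ℕ → ℕ → List Instr
  fetches pc zero    = []
  fetches pc (suc k) = fetch P pc ∷ fetches (suc pc) k

  after : ℕ → List SInstr → ℕ
  after pc []       = pc
  after pc (_ ∷ is) = after (suc pc) is

  good-instr : ∀ {t pc V} i → fetch P pc ≡ compile i → Good t (suc pc) (exec₁ i V) → Good (suc t) pc V
  good-instr {V = V} (constˢ r c) e g .outcome R RV rewrite e = g .outcome _ (update-matches {R} {V} r c RV)
  good-instr {V = V} (arithˢ o r a b) e g .outcome R RV rewrite e | RV a | RV b = g .outcome _ (update-matches {R} {V} r _ RV)
  good-instr {V = V} (sqrtˢ r a) e g .outcome R RV rewrite e | RV a = g .outcome _ (update-matches {R} {V} r _ RV)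

  good-block : ∀ {t pc V V′} is → fetches pc (length is) ≡ map compile is → exec is V ≡ V′ →
               Good t (after pc is) V′ → Good (length is ℕ.+ t) pc V
  good-block [] _ refl g = g
  good-block {V = V} (i ∷ is) e e′ g =
    good-instr {V = V} i (Listₚ.∷-injectiveˡ e) (good-block is (Listₚ.∷-injectiveʳ e) e′ g)

  good-jle : ∀ {t pc V l} a b → fetch P pc ≡ jle (toℕ a) (toℕ b) l →
             (lookup V a ≤ lookup V b → Good t l V) →
             (¬ (lookup V a ≤ lookup V b) → Good t (suc pc) V) → Good (suc t) pc V
  good-jle {V = V} a b e g h .outcome R RV rewrite e | RV a | RV b with lookup V a ≤? lookup V b
  ... | yes p = g p .outcome R RV
  ... | no ¬p = h ¬p .outcome R RV

  good-jmp : ∀ {t pc V l} → fetch P pc ≡ jmp l → Good t l V → Good (suc t) pc V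
  good-jmp e g .outcome R RV rewrite e = g .outcome R RV

  good-halt : ∀ {t pc V} → fetch P pc ≡ halt → (∀ R → Matches R V → Post R) → Good (suc t) pc V
  good-halt e post .outcome R RV rewrite e = R , refl , post R RV

-- Register map: 0 n, 1–2 p, 3 the constant 0, 4–5 u, 6–7 v, 8–13 scratch.

infix 5 _≔_[_]_
_≔_[_]_ : Reg → Reg → Op → Reg → SInstr
r ≔ a [ o ] b = arithˢ o r a b

-- Leaves quadHi in register 12 and quadLo in register 13.
quadCode : (x y dx dy : Reg) → List SInstr
quadCode x y dx dy =
    (# 10 ≔ dx [ mul ] dy)
  ∷ (# 10 ≔ # 10 [ add ] # 10)
  ∷ (# 11 ≔ dx [ mul ] y)
  ∷ (# 12 ≔ dy [ mul ] x)
  ∷ (# 11 ≔ # 11 [ sub ] # 12)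
  ∷ (# 12 ≔ x [ mul ] y)
  ∷ (# 12 ≔ # 12 [ sub ] # 0)
  ∷ (# 12 ≔ # 10 [ mul ] # 12)
  ∷ (# 12 ≔ # 12 [ add ] # 12)
  ∷ (# 13 ≔ # 11 [ mul ] # 11)
  ∷ (# 12 ≔ # 12 [ add ] # 13)
  ∷ sqrtˢ (# 12) (# 12)
  ∷ (# 13 ≔ # 12 [ sub ] # 11)
  ∷ (# 13 ≔ # 13 [ div ] # 10)
  ∷ (# 13 ≔ # 3 [ sub ] # 13)
  ∷ (# 12 ≔ # 11 [ add ] # 12)
  ∷ (# 12 ≔ # 12 [ div ] # 10)
  ∷ []

steepCode flatCode slidePre slidePost probePre testCode finishPost advanceCode : List SInstr

steepCode =
    constˢ (# 4) (+ 1)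
  ∷ constˢ (# 6) (+ 1)
  ∷ (# 8 ≔ # 1 [ add ] # 4)
  ∷ (# 9 ≔ # 3 [ sub ] # 0)
  ∷ (# 9 ≔ # 9 [ div ] # 8)
  ∷ (# 9 ≔ # 3 [ sub ] # 9)
  ∷ (# 5 ≔ # 2 [ sub ] # 9)
  ∷ (# 7 ≔ # 5 [ add ] # 4)
  ∷ []

-- Registers 4 and 6 still hold 1 from `steepCode`; each is read as that constant before being
-- overwritten.
flatCode =
    (# 8 ≔ # 2 [ sub ] # 4)
  ∷ (# 9 ≔ # 3 [ sub ] # 0)
  ∷ (# 9 ≔ # 9 [ div ] # 8)
  ∷ (# 9 ≔ # 3 [ sub ] # 9)
  ∷ (# 4 ≔ # 9 [ sub ] # 1)
  ∷ (# 6 ≔ # 4 [ sub ] # 6)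
  ∷ constˢ (# 5) (+ 1)
  ∷ constˢ (# 7) (+ 1)
  ∷ []

slidePre =
    (# 8 ≔ # 1 [ add ] # 4)
  ∷ (# 9 ≔ # 2 [ sub ] # 5)
  ∷ []

slidePost =
    (# 8 ≔ # 12 [ mul ] # 6)
  ∷ (# 4 ≔ # 4 [ add ] # 8)
  ∷ (# 8 ≔ # 12 [ mul ] # 7)
  ∷ (# 5 ≔ # 5 [ add ] # 8)
  ∷ []

probePre =
    (# 8 ≔ # 1 [ add ] # 6)
  ∷ (# 9 ≔ # 2 [ sub ] # 7)
  ∷ []

testCode =
    (# 10 ≔ # 13 [ mul ] # 4)
  ∷ (# 10 ≔ # 10 [ add ] # 6)
  ∷ (# 11 ≔ # 13 [ mul ] # 5)
  ∷ (# 11 ≔ # 11 [ add ] # 7)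
  ∷ (# 8 ≔ # 1 [ add ] # 10)
  ∷ (# 9 ≔ # 2 [ sub ] # 11)
  ∷ (# 8 ≔ # 8 [ mul ] # 9)
  ∷ []

finishPost =
    (# 8 ≔ # 12 [ mul ] # 4)
  ∷ (# 9 ≔ # 12 [ mul ] # 5)
  ∷ (# 0 ≔ # 1 [ add ] # 8)
  ∷ (# 1 ≔ # 2 [ sub ] # 9)
  ∷ []

advanceCode =
    (# 6 ≔ # 10 [ sub ] # 4)
  ∷ (# 7 ≔ # 11 [ sub ] # 5)
  ∷ (# 4 ≔ # 6 [ add ] # 4)
  ∷ (# 5 ≔ # 7 [ add ] # 5)
  ∷ []

-- Jump targets are absolute; the address of each block is on its right.
program : Program
program =
  map compile steepCode                                -- 0
  ++ jle 4 5 17                                        -- 8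
  ∷ map compile flatCode                               -- 9
  ++ map compile slidePre                              -- 17
  ++ map compile (quadCode (# 8) (# 9) (# 6) (# 7))    -- 19
  ++ map compile slidePost                             -- 36
  ++ map compile probePre                              -- 40
  ++ map compile (quadCode (# 8) (# 9) (# 4) (# 5))    -- 42
  ++ jle 13 3 68                                       -- 59
  ∷ map compile testCode                               -- 60
  ++ jle 0 8 90                                        -- 67
  ∷ map compile (quadCode (# 1) (# 2) (# 4) (# 5))     -- 68
  ++ map compile finishPost                            -- 85
  ++ halt                                              -- 89
  ∷ map compile advanceCode                            -- 90
  ++ jmp 17                                            -- 94
  ∷ []

module _ (N px py : ℤ) where

  store : (ux uy vx vy x y a b c d : ℤ) → Store
  store ux uy vx vy x y a b c d = N ∷ px ∷ py ∷ + 0 ∷ ux ∷ uy ∷ vx ∷ vy ∷ x ∷ y ∷ a ∷ b ∷ c ∷ d ∷ []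

  opaque
    unfolding quadLo quadHi

    exec-quad-v : ∀ ux uy vx vy x y a b c d →
      exec (quadCode (# 8) (# 9) (# 6) (# 7)) (store ux uy vx vy x y a b c d)
      ≡ store ux uy vx vy x y (quad2A vx vy) (quadB x y vx vy) (quadHi N x y vx vy) (quadLo N x y vx vy)
    exec-quad-v ux uy vx vy x y a b c d = refl

    exec-quad-u : ∀ ux uy vx vy x y a b c d →
      exec (quadCode (# 8) (# 9) (# 4) (# 5)) (store ux uy vx vy x y a b c d)
      ≡ store ux uy vx vy x y (quad2A ux uy) (quadB x y ux uy) (quadHi N x y ux uy) (quadLo N x y ux uy)
    exec-quad-u ux uy vx vy x y a b c d = refl

    exec-quad-p : ∀ ux uy vx vy x y a b c d →
      exec (quadCode (# 1) (# 2) (# 4) (# 5)) (store ux uy vx vy x y a b c d)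
      ≡ store ux uy vx vy x y (quad2A ux uy) (quadB px py ux uy) (quadHi N px py ux uy) (quadLo N px py ux uy)
    exec-quad-p ux uy vx vy x y a b c d = refl

-- Correctness and the instruction count

n<2^1+log : ∀ n → n ℕ.< 2 ^ suc ⌊log₂ n ⌋
n<2^1+log n with 2 ^ suc ⌊log₂ n ⌋ ℕ.≤? n
... | no h  = ℕₚ.≰⇒> h
... | yes h = ⊥-elim (ℕₚ.1+n≰n (subst (ℕ._≤ ⌊log₂ n ⌋) (⌊log₂[2^n]⌋≡n (suc ⌊log₂ n ⌋)) (⌊log₂⌋-mono-≤ h)))

module Correct (n : ℕ) (n≥1 : + 1 ≤ + n) (px py : ℤ) (vtx : IsVertex n (px , py)) where

  open Search n n≥1 px py vtx
  open Hoare program (λ R → Next (R 0) (R 1))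

  good-finish : ∀ {t ux uy vx vy} x y a b c d → Cone ux uy vx vy →
    (∀ t → NN t → ¬ F (t * ux + vx) (t * uy + vy)) →
    Good (22 ℕ.+ t) 68 (store (+ n) px py ux uy vx vy x y a b c d)
  good-finish {t} {ux} {uy} {vx} {vy} x y a b c d cone none =
    good-block (quadCode (# 1) (# 2) (# 4) (# 5)) refl (exec-quad-p (+ n) px py ux uy vx vy x y a b c d)
      (good-block {V′ = V′} finishPost refl refl (good-halt refl λ R RV →
        subst₂ Next (sym (RV (# 0))) (sym (RV (# 1))) (Finish.next cone none)))
    where
    m = quadHi (+ n) px py ux uy
    V′ : Store
    V′ = (px + m * ux) ∷ (py - m * uy) ∷ py ∷ + 0 ∷ ux ∷ uy ∷ vx ∷ vy ∷ m * ux ∷ m * uy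
         ∷ quad2A ux uy ∷ quadB px py ux uy ∷ m ∷ quadLo (+ n) px py ux uy ∷ []

  -- m bounds the rounds left, since uy doubles in each. The costliest round is a last one: 51
  -- instructions up to and including the second test, then 22 to finish. A continuing round takes
  -- 56, which leaves the 17 given up by `weaken`.
  loop : ∀ m {ux uy vx vy} x y a b c d → Cone ux uy vx vy → py + + 1 ≤ + (2 ^ m) * uy →
    Good (m ℕ.* 73) 17 (store (+ n) px py ux uy vx vy x y a b c d)
  -- Here uy > p_y, so p + u would lie below the horizontal axis.
  loop zero {ux} {uy} x y a b c d cone bound = ⊥-elim (absurd (gap bound ⊕ proj₁ (proj₂ (Cone.fu cone))) (eq py uy))
    where
    eq : ∀ p u → + 1 * u - (p + + 1) + (p - u) ≡ - (+ 1)
    eq = solve-∀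
  loop (suc m) {ux} {uy} {vx} {vy} x y a b c d cone bound =
    good-block {V′ = store (+ n) px py ux uy vx vy (px + ux) (py - uy) a b c d} slidePre refl refl
    (good-block (quadCode (# 8) (# 9) (# 6) (# 7)) refl (exec-quad-v (+ n) px py ux uy vx vy (px + ux) (py - uy) a b c d)
    (good-block {V′ = store (+ n) px py ux₁ uy₁ vx vy (j * vy) (py - uy) A₁ B₁ j L₁} slidePost refl refl
    (good-block {V′ = store (+ n) px py ux₁ uy₁ vx vy (px + vx) (py - vy) A₁ B₁ j L₁} probePre refl refl
    (good-block (quadCode (# 8) (# 9) (# 4) (# 5)) refl
      (exec-quad-u (+ n) px py ux₁ uy₁ vx vy (px + vx) (py - vy) A₁ B₁ j L₁)
    (good-jle (# 13) (# 3) refl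
      (λ k≤0 → good-finish _ _ _ _ _ _ slide (k≤0⇒none k≤0))
      (λ k≰0 →
        good-block {V′ = store (+ n) px py ux₁ uy₁ vx vy ((px + (k * ux₁ + vx)) * (py - (k * uy₁ + vy))) (py - (k * uy₁ + vy))
                      (k * ux₁ + vx) (k * uy₁ + vy) H₁ k} testCode refl refl
        (good-jle (# 0) (# 8) refl
          (λ h → good-block {V′ = store (+ n) px py (k * ux₁ + vx - ux₁ + ux₁) (k * uy₁ + vy - uy₁ + uy₁) (k * ux₁ + vx - ux₁) (k * uy₁ + vy - uy₁)
                      ((px + (k * ux₁ + vx)) * (py - (k * uy₁ + vy))) (py - (k * uy₁ + vy))
                      (k * ux₁ + vx) (k * uy₁ + vy) H₁ k} advanceCode refl refl
            (good-jmp refl (weaken (ℕₚ.m≤n+m (m ℕ.* 73) 17)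
              (loop m _ _ _ _ _ _ (advance (≰⇒1+≤ k≰0) h) (bound′ (≰⇒1+≤ k≰0) h)))))
          (λ ¬h → good-finish _ _ _ _ _ _ slide (k∉⇒none ¬h)))))))))
    where
    open Slide cone
    open Advance slide
    j L₁ A₁ B₁ H₁ ux₁ uy₁ : ℤ
    j   = quadHi (+ n) (px + ux) (py - uy) vx vy
    L₁  = quadLo (+ n) (px + ux) (py - uy) vx vy
    A₁  = quad2A vx vy
    B₁  = quadB (px + ux) (py - uy) vx vy
    ux₁ = ux + j * vx
    uy₁ = uy + j * vy
    H₁  = quadHi (+ n) (px + vx) (py - vy) ux₁ uy₁
    bound′ : (k≥1 : + 1 ≤ k) (h : + n ≤ (px + (k * (ux + j * vx) + vx)) * (py - (k * (uy + j * vy) + vy))) →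
             py + + 1 ≤ + (2 ^ m) * (k * (uy + j * vy) + vy - (uy + j * vy) + (uy + j * vy))
    bound′ k≥1 h = by (gap bound₂ ⊕ +≤+ (ℕ.z≤n {2 ^ m}) ⊗ (gap (doubling k≥1 h slide-max) ⊕ gap uy≤slide ⊕ gap uy≤slide))
                  (eq (+ (2 ^ m)) py uy (uy + j * vy) (k * (uy + j * vy) + vy - (uy + j * vy) + (uy + j * vy)))
      where
      bound₂ : py + + 1 ≤ + 2 * + (2 ^ m) * uy
      bound₂ = subst (λ z → py + + 1 ≤ z * uy) (ℤₚ.pos-* 2 (2 ^ m)) bound
      eq : ∀ K p u u₁ u₂ → + 2 * K * u - (p + + 1) + K * (u₂ - + 2 * u₁ + (u₁ - u) + (u₁ - u)) ≡ K * u₂ - (p + + 1)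
      eq = solve-∀


  good-start : + 2 ≤ py → Good (17 ℕ.+ suc ⌊log₂ n ⌋ ℕ.* 73) 0
    (store (+ n) px py (+ 0) (+ 0) (+ 0) (+ 0) (+ 0) (+ 0) (+ 0) (+ 0) (+ 0) (+ 0))
  good-start py≥2 =
    good-block {V′ = store (+ n) px py (+ 1) drop₁ (+ 1) (drop₁ + + 1) (px + + 1) d (+ 0) (+ 0) (+ 0) (+ 0)} steepCode refl refl
    (good-jle (# 4) (# 5) refl
      -- The steep branch skips the 8 instructions of `flatCode`.
      (λ s≥1 → weaken (ℕₚ.m≤n+m (suc ⌊log₂ n ⌋ ℕ.* 73) 8)
        (loop (suc ⌊log₂ n ⌋) _ _ _ _ _ _ (start-steep s≥1) (bound s≥1)))
      (λ ¬s≥1 →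
        good-block {V′ = store (+ n) px py reach₁ (+ 1) (reach₁ - + 1) (+ 1) (py - + 1) e (+ 0) (+ 0) (+ 0) (+ 0)} flatCode refl refl
        (loop (suc ⌊log₂ n ⌋) _ _ _ _ _ _ (start-flat ¬s≥1 py≥2) (bound ≤-refl))))
    where
    d = ceilDiv (+ n) (px + + 1)
    e = ceilDiv (+ n) (py - + 1)
    bound : ∀ {u} → + 1 ≤ u → py + + 1 ≤ + (2 ^ suc ⌊log₂ n ⌋) * u
    bound {u} u≥1 = by (gap py≤n ⊕ gap n<2^ ⊕ +≤+ (ℕ.z≤n {2 ^ suc ⌊log₂ n ⌋}) ⊗ gap u≥1) (eq py (+ n) (+ (2 ^ suc ⌊log₂ n ⌋)) u)
      where
      n<2^ : + n + + 1 ≤ + (2 ^ suc ⌊log₂ n ⌋)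
      n<2^ = subst (_≤ + (2 ^ suc ⌊log₂ n ⌋)) (cong +_ (ℕₚ.+-comm 1 n)) (+≤+ (n<2^1+log n))
      eq : ∀ p N K u → N - p + (K - (N + + 1)) + K * (u - + 1) ≡ K * u - (p + + 1)
      eq = solve-∀

  initial-matches : Matches (initRegs n (px , py))
    (store (+ n) px py (+ 0) (+ 0) (+ 0) (+ 0) (+ 0) (+ 0) (+ 0) (+ 0) (+ 0) (+ 0))
  initial-matches zero                = refl
  initial-matches (suc zero)          = refl
  initial-matches (suc (suc zero))    = refl
  initial-matches (suc (suc (suc r))) = sym (Vecₚ.lookup-replicate r (+ 0))

  -- With L = ⌊log₂ n⌋ the left side is (17 + 73) + 73 L, which gives the constant 90.
  fuel : 17 ℕ.+ suc ⌊log₂ n ⌋ ℕ.* 73 ℕ.≤ 90 ℕ.* (⌊log₂ n ⌋ ℕ.+ 1)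
  fuel = subst (90 ℕ.+ L ℕ.* 73 ℕ.≤_) (trans (ℕₚ.*-comm (suc L) 90) (cong (90 ℕ.*_) (ℕₚ.+-comm 1 L)))
           (ℕₚ.+-monoʳ-≤ 90 (ℕₚ.*-monoʳ-≤ L (ℕₚ.m≤m+n 73 17)))
    where
    L = ⌊log₂ n ⌋

  correct : ∀ qx qy → IsVertex n (qx , qy) → px < qx →
    ∃ λ R → run program (90 ℕ.* (⌊log₂ n ⌋ ℕ.+ 1)) 0 (initRegs n (px , py)) ≡ just R
          × IsNextVertex n (px , py) (R 0 , R 1)
  correct qx qy vq px<qx =
    let R , halts , next = weaken fuel (good-start (next⇒py≥2 qx qy vq px<qx)) .outcome (initRegs n (px , py)) initial-matches
    in R , halts , Next.isNext next

theorem1p3 : Σ Program λ P → Σ ℕ λ c →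
    ∀ (n : ℕ) (p : ℤ × ℤ) → IsVertex n p →
    (∃ λ q → IsNextVertex n p q) →
    ∃ λ (R : Regs) →
    run P (c ℕ.* (⌊log₂ n ⌋ ℕ.+ 1)) 0 (initRegs n p) ≡ just R
    × IsNextVertex n p (R 0 , R 1)
theorem1p3 = program , 90 , λ where
  -- H₀ is the whole quadrant. As qx > px ≥ 0, the left neighbour of q lies in it, so q is not a
  -- vertex and the case is void.
  zero (px , py) vtx ((qx , qy) , vq , px<qx , _) →
    let px≥0 = proj₁ (vertex⇒NN px py vtx)
        qy≥0 = proj₂ (vertex⇒NN qx qy vq)
        qx-1≥0 = subst NN (ℤₚ.+-comm (- (+ 1)) qx) (ℤₚ.≤-trans px≥0 (ℤₚ.i<j⇒i≤pred[j] px<qx))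
    in ⊥-elim (vertex⇒left∉H qx qy vq (qx-1≥0 , qy≥0 , qx-1≥0 ⊗ qy≥0))
  (suc n) (px , py) vtx ((qx , qy) , vq , px<qx , _) →
    Correct.correct (suc n) (+≤+ (ℕ.s≤s ℕ.z≤n)) px py vtx qx qy vq px<qx
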